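{- Let $n\ge3$ and $r\in\{1,\dots,n-1\}$. For any $k\in\mathbb{Z}$, $$B^{r,1}\cong\overline{\mathcal{M}}\Big(\prod_{i=1}^rX_{i,k}\Big)$$ as $U_q'(\widehat{\mathfrak{sl}}_n)$-crystals, where $X_{i,k}=Y_{i-1,k+1}^{ -1}Y_{i,k}$ and $\overline{\mathcal{M}}(m)$ is the closure of the Nakajima monomial $m$ under the modified operators $\overline{e}_i,\overline{f}_i$, $i\in I$.
   Context: Crystals. $I=\mathbb{Z}/n\mathbb{Z}=\{0,1,\dots,n-1\}$ is the index set of $\widehat{\mathfrak{sl}}_n$ (type $A_{n-1}^{(1)}$), with fundamental weights $\Lambda_i$, and simple roots $\alpha_i=2\Lambda_i-\Lambda_{i-1}-\Lambda_{i+1}$ as $U_q'(\widehat{\mathfrak{sl}}_n)$-weights (that is, modulo the null root $\delta$). A $U_q'(\widehat{\mathfrak{sl}}_n)$-crystal is a set $B$ with maps $e_i,f_i:B\to B\sqcup\{0\}$, $\varepsilon_i,\varphi_i:B\to\mathbb{Z}$ and $\mathrm{wt}:B\to\bigoplus_i\mathbb{Z}\Lambda_i$ satisfying the usual crystal axioms. It is regular if $\varepsilon_i(b)=\max\{p\mid e_i^pb\ne0\}$ and $\varphi_i(b)=\max\{p\mid f_i^pb\neq0\}$. An isomorphism of crystals is a bijection that preserves $\mathrm{wt},\varepsilon_i,\varphi_i$ and commutes with all $e_i,f_i$ (with $0\mapsto 0$). Nakajima monomials. $\mathcal{M}$ is the set of Laurent monomials $m=\prod_{i\in I,k\in\mathbb{Z}}Y_{i,k}^{y_{i,k}}$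 (finitely many nonzero exponents) in commuting variables $Y_{i,k}$. Put $\mathrm{wt}(m)=\sum_{i,k}y_{i,k}\Lambda_i$, $\ \varepsilon_i(m)=-\min_{k\in\mathbb{Z}}\sum_{t\ge k}y_{i,t}$, $\ \varphi_i(m)=\max_{k\in\mathbb{Z}}\sum_{t\le k}y_{i,t}$, $\ k_e(m)=\max\{k\mid \varepsilon_i(m)=-\sum_{t\ge k}y_{i,t}\}$ (used when $\varepsilon_i(m)>0$), $\ k_f(m)=\min\{k\mid\varphi_i(m)=\sum_{t\le k}y_{i,t}\}$ (used when $\varphi_i(m)>0$). With $A_{i,k}=Y_{i,k}Y_{i,k+1}Y_{i-1,k+1}^{ -1}Y_{i+1,k}^{ -1}$, set $e_i(m)=0$ if $\varepsilon_i(m)=0$ and $e_i(m)=m\,A_{i,k_e(m)-1}$ otherwise; $f_i(m)=0$ if $\varphi_i(m)=0$ and $f_i(m)=m\,A_{i,k_f(m)}^{ -1}$ otherwise. Modified operators. Put $X_{i,k}=Y_{i-1,k+1}^{ -1}Y_{i,k}$ (first indices mod $n$); distinct $X_{i,k}$ are multiplicatively independent, so a monomial in the $X_{i,k}$ has a unique such expression. For a monomial $m$ in the $X_{i,k}$, $\overline{f}_i(m)=f_i(m)$ if $f_i(m)\neq 0$ and $f_i(m)$, written in the variables $X_{j,l}$, does not contain a factor $X_{j,l}^2$ for any $(j,l)\in I\times\mathbb{Z}$; otherwise $\overline{f}_i(m)=0$. $\overline{e}_i$ is defined in the same way from $e_i$. The set $\overline{\mathcal{M}}(m)$ is the closure of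 $m$ under all $\overline{e}_i,\overline{f}_i$ (excluding $0$), with weight function $\mathrm{wt}(m')=\sum_{i\in I,k\in\mathbb{Z}}y_{i,k}\Lambda_i$ for $m'=\prod_{i\in I,k\in\mathbb{Z}}Y_{i,k}^{y_{i,k}}\in\overline{\mathcal{M}}(m)$, operators $\overline e_i,\overline f_i$, and with $\varepsilon_i,\varphi_i$ on $\overline{\mathcal M}(m)$ being the string lengths of $\overline{e}_i,\overline{f}_i$ (so that it is regular). The Kirillov--Reshetikhin crystal $B^{r,1}$ is the regular $U_q'(\widehat{\mathfrak{sl}}_n)$-crystal realized as follows: its elements are the vectors $(x_1,\dots,x_n)\in\{0,1\}^n$ with $\sum_ix_i=r$ (indices mod $n$, $x_0=x_n$); $\mathrm{wt}(x)=\sum_{i\in I}(x_i-x_{i+1})\Lambda_i$; for $i\in I$, $f_i(x)$ is obtained by replacing $(x_i,x_{i+1})=(1,0)$ by $(0,1)$ if $(x_i,x_{i+1})=(1,0)$, and $f_i(x)=0$ otherwise; $e_i(x)$ is obtained by replacing $(x_i,x_{i+1})=(0,1)$ by $(1,0)$ if $(x_i,x_{i+1})=(0,1)$, and $e_i(x)=0$ otherwise; $\varepsilon_i,\varphi_i$ are the string lengths. -}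

module Defs where

open import Level using (0ℓ)
open import Data.Bool using (Bool; true; false; if_then_else_; _∧_; not)
open import Data.Nat as ℕ using (ℕ; zero; suc; NonZero; _⊔_)
import Data.Nat.Properties as ℕₚ
open import Data.Nat.DivMod using (_mod_; _%_; %-distribˡ-+; m%n%n≡m%n; [m+n]%n≡m%n; m<n⇒m%n≡m)
open import Data.Integer as ℤ using (ℤ; +_; -[1+_]; 0ℤ; 1ℤ; _+_; _-_; -_; ∣_∣)
import Data.Integer.Properties as ℤₚ
open import Data.Integer.Tactic.RingSolver using (solve-∀)
open import Data.Fin as Fin using (Fin; toℕ)
import Data.Fin.Properties as Finₚ
open import Data.Fin.Subset as Subset using (Subset)
open import Data.List using (List; map; foldr; filter; upTo; _++_)
open import Data.List.Relation.Unary.All as All using (All)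
open import Data.List.Membership.Propositional using (_∈_)
open import Data.List.Membership.Propositional.Properties using (∈-map⁺; ∈-++⁺ˡ; ∈-++⁺ʳ; ∈-upTo⁺)
open import Data.Maybe as Maybe using (Maybe; just; nothing; maybe′; Is-just)
open import Data.Maybe.Relation.Binary.Pointwise using (Pointwise)
open import Data.Product using (Σ; _×_; _,_; proj₁; proj₂; Σ-syntax)
open import Data.Vec using ([]; _∷_; lookup; _[_]≔_)
open import Function using (_∘_; _⇔_; mk⇔)
open import Function.Bundles using (Bijection)
open import Relation.Binary.Bundles using (Setoid)
import Relation.Binary.Construct.On as On
open import Relation.Binary.PropositionalEquality hiding (setoid)
open import Relation.Binary.PropositionalEquality.Properties using () renaming (setoid to ≡-setoid)
open import Relation.Nullary using (¬_; Dec; yes; no; does; contradiction)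
open import Relation.Nullary.Decidable using (¬?; does-⇔) renaming (map′ to mapDec)

------------------------------------------------------------------------
-- Generic operations on partial operators; `nothing` plays the role of 0.

attach : {A : Set} {P : A → Set} (o : Maybe A) →
         (∀ {a} → o ≡ just a → P a) → Maybe (Σ A P)
attach (just a) p = just (a , p refl)
attach nothing  p = nothing

unless : {A : Set} → Bool → A → Maybe A
unless c a = if c then nothing else just a

unless-just : {A : Set} (c : Bool) {a b : A} → unless c a ≡ just b → a ≡ b
unless-just false refl = refl

iterate : {A : Set} → (A → Maybe A) → ℕ → A → Maybe A
iterate op zero    b = just b
iterate op (suc p) b = op b Maybe.>>= iterate op p

-- The largest p ≤ fuel such that op can be applied p times to b.
stringLength : {A : Set} → ℕ → (A → Maybe A) → A → ℕ
stringLength zero       op b = 0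
stringLength (suc fuel) op b = maybe′ (λ b′ → suc (stringLength fuel op b′)) 0 (op b)

IsStringLength : {A : Set} → (A → Maybe A) → A → ℤ → Set
IsStringLength op b z = Σ[ p ∈ ℕ ] (z ≡ + p) × Is-just (iterate op p b) ×
                                   (∀ q → Is-just (iterate op q b) → q ℕ.≤ p)

------------------------------------------------------------------------
-- The index set I = ℤ/nℤ is Fin n.

module _ {n : ℕ} .{{_ : NonZero n}} where

  next : Fin n → Fin n
  next i = suc (toℕ i) mod n

  prev : Fin n → Fin n
  prev i = (toℕ i ℕ.+ ℕ.pred n) mod n

  private
    toℕ-mod : ∀ a → toℕ (a mod n) ≡ a % n
    toℕ-mod a = Finₚ.toℕ-fromℕ< _

    toℕ% : (i : Fin n) → toℕ i % n ≡ toℕ i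
    toℕ% i = m<n⇒m%n≡m (Finₚ.toℕ<n i)

    +-%ˡ : ∀ a b → (a % n ℕ.+ b) % n ≡ (a ℕ.+ b) % n
    +-%ˡ a b = begin
      (a % n ℕ.+ b) % n          ≡⟨ %-distribˡ-+ (a % n) b n ⟩
      (a % n % n ℕ.+ b % n) % n  ≡⟨ cong (λ c → (c ℕ.+ b % n) % n) (m%n%n≡m%n a n) ⟩
      (a % n ℕ.+ b % n) % n      ≡⟨ %-distribˡ-+ a b n ⟨
      (a ℕ.+ b) % n              ∎
      where open ≡-Reasoning

    suc-+-pred : ∀ a → suc a ℕ.+ ℕ.pred n ≡ a ℕ.+ n
    suc-+-pred a = trans (sym (ℕₚ.+-suc a (ℕ.pred n))) (cong (a ℕ.+_) (ℕₚ.suc-pred n))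

  prev-next : ∀ i → prev (next i) ≡ i
  prev-next i = Finₚ.toℕ-injective (begin
    toℕ (prev (next i))                       ≡⟨ toℕ-mod _ ⟩
    (toℕ (next i) ℕ.+ ℕ.pred n) % n           ≡⟨ cong (λ a → (a ℕ.+ ℕ.pred n) % n) (toℕ-mod _) ⟩
    (suc (toℕ i) % n ℕ.+ ℕ.pred n) % n        ≡⟨ +-%ˡ (suc (toℕ i)) (ℕ.pred n) ⟩
    (suc (toℕ i) ℕ.+ ℕ.pred n) % n            ≡⟨ cong (_% n) (suc-+-pred (toℕ i)) ⟩
    (toℕ i ℕ.+ n) % n                         ≡⟨ [m+n]%n≡m%n (toℕ i) n ⟩
    toℕ i % n                                 ≡⟨ toℕ% i ⟩
    toℕ i                                     ∎)
    where open ≡-Reasoning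

  next-prev : ∀ i → next (prev i) ≡ i
  next-prev i = Finₚ.toℕ-injective (begin
    toℕ (next (prev i))                       ≡⟨ toℕ-mod _ ⟩
    suc (toℕ (prev i)) % n                    ≡⟨ cong (λ a → suc a % n) (toℕ-mod _) ⟩
    suc ((toℕ i ℕ.+ ℕ.pred n) % n) % n        ≡⟨ cong (_% n) (ℕₚ.+-comm 1 _) ⟩
    ((toℕ i ℕ.+ ℕ.pred n) % n ℕ.+ 1) % n      ≡⟨ +-%ˡ (toℕ i ℕ.+ ℕ.pred n) 1 ⟩
    (toℕ i ℕ.+ ℕ.pred n ℕ.+ 1) % n            ≡⟨ cong (_% n) (ℕₚ.+-comm _ 1) ⟩
    (suc (toℕ i) ℕ.+ ℕ.pred n) % n            ≡⟨ cong (_% n) (suc-+-pred (toℕ i)) ⟩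
    (toℕ i ℕ.+ n) % n                         ≡⟨ [m+n]%n≡m%n (toℕ i) n ⟩
    toℕ i % n                                 ≡⟨ toℕ% i ⟩
    toℕ i                                     ∎)
    where open ≡-Reasoning

------------------------------------------------------------------------
-- A weight is its vector of coefficients on Λ₀, …, Λₙ₋₁, so that
-- ⟨hᵢ , w⟩ is w i.

Weight : ℕ → Set
Weight n = Fin n → ℤ

Λ : ∀ {n} → Fin n → Weight n
Λ i j = if does (i Fin.≟ j) then 1ℤ else 0ℤ

α : ∀ {n} .{{_ : NonZero n}} → Fin n → Weight n
α i j = + 2 ℤ.* Λ i j - Λ (prev i) j - Λ (next i) j

-- The data of a crystal, without axioms; the underlying set is a setoid.
record PreCrystal (n : ℕ) : Set₁ where
  field
    setoid : Setoid 0ℓ 0ℓ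
  open Setoid setoid public using (Carrier; _≈_)
  field
    wt  : Carrier → Weight n
    ε φ : Fin n → Carrier → ℤ
    e f : Fin n → Carrier → Maybe Carrier

  infix 4 _≈?_
  _≈?_ : Maybe Carrier → Maybe Carrier → Set
  _≈?_ = Pointwise _≈_

record IsCrystal {n : ℕ} .{{_ : NonZero n}} (B : PreCrystal n) : Set where
  open PreCrystal B
  field
    wt-cong : ∀ {b b′} → b ≈ b′ → ∀ j → wt b j ≡ wt b′ j
    ε-cong  : ∀ i {b b′} → b ≈ b′ → ε i b ≡ ε i b′
    φ-cong  : ∀ i {b b′} → b ≈ b′ → φ i b ≡ φ i b′
    e-cong  : ∀ i {b b′} → b ≈ b′ → e i b ≈? e i b′
    f-cong  : ∀ i {b b′} → b ≈ b′ → f i b ≈? f i b′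

    φ≡ε+wt  : ∀ i b → φ i b ≡ ε i b + wt b i
    wt-e    : ∀ i {b b′} → e i b ≈? just b′ → ∀ j → wt b′ j ≡ wt b j + α i j
    ε-e     : ∀ i {b b′} → e i b ≈? just b′ → ε i b′ ≡ ε i b - 1ℤ
    φ-e     : ∀ i {b b′} → e i b ≈? just b′ → φ i b′ ≡ φ i b + 1ℤ
    wt-f    : ∀ i {b b′} → f i b ≈? just b′ → ∀ j → wt b′ j ≡ wt b j - α i j
    ε-f     : ∀ i {b b′} → f i b ≈? just b′ → ε i b′ ≡ ε i b + 1ℤ
    φ-f     : ∀ i {b b′} → f i b ≈? just b′ → φ i b′ ≡ φ i b - 1ℤ
    f⇔e     : ∀ i b b′ → (f i b ≈? just b′) ⇔ (e i b′ ≈? just b)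

record IsRegularCrystal {n : ℕ} .{{_ : NonZero n}} (B : PreCrystal n) : Set where
  open PreCrystal B
  field
    isCrystal : IsCrystal B
    ε-regular : ∀ i b → IsStringLength (e i) b (ε i b)
    φ-regular : ∀ i b → IsStringLength (f i) b (φ i b)

infix 4 _≅_
record _≅_ {n : ℕ} (B C : PreCrystal n) : Set where
  private
    module B = PreCrystal B
    module C = PreCrystal C
  field
    bijection : Bijection B.setoid C.setoid
  open Bijection bijection using (to)
  field
    wt-pres : ∀ b j → C.wt (to b) j ≡ B.wt b j
    ε-pres  : ∀ i b → C.ε i (to b) ≡ B.ε i b
    φ-pres  : ∀ i b → C.φ i (to b) ≡ B.φ i b
    e-comm  : ∀ i b → C.e i (to b) C.≈? Maybe.map to (B.e i b)
    f-comm  : ∀ i b → C.f i (to b) C.≈? Maybe.map to (B.f i b)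

------------------------------------------------------------------------
-- Laurent monomials in commuting variables indexed by I × ℤ, as finitely
-- supported exponent functions.  The bound is only a witness of finiteness
-- and is ignored by the equality _≋_.

record Laurent (n : ℕ) : Set where
  no-eta-equality
  field
    exponent : Fin n → ℤ → ℤ
    bound    : ℕ
    vanishes : ∀ i k → bound ℕ.< ∣ k ∣ → exponent i k ≡ 0ℤ
open Laurent public

infix 4 _≋_
_≋_ : ∀ {n} → Laurent n → Laurent n → Set
m ≋ m′ = ∀ i k → exponent m i k ≡ exponent m′ i k

laurentSetoid : ℕ → Setoid 0ℓ 0ℓ
laurentSetoid n = record
  { Carrier       = Laurent n
  ; _≈_           = _≋_
  ; isEquivalence = record
    { refl  = λ i k → refl
    ; sym   = λ p i k → sym (p i k)
    ; trans = λ p q i k → trans (p i k) (q i k)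
    }
  }

one : ∀ {n} → Laurent n
one .exponent _ _   = 0ℤ
one .bound          = 0
one .vanishes _ _ _ = refl

infixl 7 _·_
_·_ : ∀ {n} → Laurent n → Laurent n → Laurent n
(m · m′) .exponent i k    = exponent m i k + exponent m′ i k
(m · m′) .bound           = bound m ⊔ bound m′
(m · m′) .vanishes i k lt = cong₂ _+_
  (vanishes m  i k (ℕₚ.≤-<-trans (ℕₚ.m≤m⊔n (bound m) (bound m′)) lt))
  (vanishes m′ i k (ℕₚ.≤-<-trans (ℕₚ.m≤n⊔m (bound m) (bound m′)) lt))

infix 8 _⁻¹
_⁻¹ : ∀ {n} → Laurent n → Laurent n
(m ⁻¹) .exponent i k    = - exponent m i k
(m ⁻¹) .bound           = bound m
(m ⁻¹) .vanishes i k lt = cong -_ (vanishes m i k lt)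

δ : ∀ {n} → Fin n → ℤ → Fin n → ℤ → ℤ
δ i k j l = if does (i Fin.≟ j) ∧ does (k ℤ.≟ l) then 1ℤ else 0ℤ

var : ∀ {n} → Fin n → ℤ → Laurent n
var i k .exponent = δ i k
var i k .bound    = ∣ k ∣
var i k .vanishes j l lt with does (i Fin.≟ j) | k ℤ.≟ l
... | _     | yes refl = contradiction lt (ℕₚ.<-irrefl refl)
... | true  | no _     = refl
... | false | no _     = refl

-- The integers of absolute value at most N (in no particular order).
window : ℕ → List ℤ
window N = map +_ (upTo (suc N)) ++ map -[1+_] (upTo N)

∈-window : ∀ {N} k → ∣ k ∣ ℕ.≤ N → k ∈ window N
∈-window (+ a)        le = ∈-++⁺ˡ (∈-map⁺ +_ (∈-upTo⁺ (ℕ.s≤s le)))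
∈-window {N} -[1+ a ] le = ∈-++⁺ʳ (map +_ (upTo (suc N))) (∈-map⁺ -[1+_] (∈-upTo⁺ le))

------------------------------------------------------------------------
-- Nakajima monomials: a Laurent n is read as a monomial in the Y i k.

-- The sums below range over all t ∈ ℤ satisfying the condition, since the
-- exponents vanish outside the window.

sumOver : ∀ {n} → Laurent n → Fin n → (ℤ → Bool) → ℤ
sumOver m i cond =
  foldr _+_ 0ℤ (map (λ t → if cond t then exponent m i t else 0ℤ) (window (bound m)))

sum : ∀ {n} → Laurent n → Fin n → ℤ
sum m i = sumOver m i (λ _ → true)

sum≥ : ∀ {n} → Laurent n → Fin n → ℤ → ℤ
sum≥ m i k = sumOver m i (λ t → does (k ℤ.≤? t))

sum≤ : ∀ {n} → Laurent n → Fin n → ℤ → ℤ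
sum≤ m i k = sumOver m i (λ t → does (t ℤ.≤? k))

wtᴹ : ∀ {n} → Laurent n → Weight n
wtᴹ m i = sum m i

-- Writing N = bound m: for k > N the sum over t ≥ k is 0, and for k ≤ - N it
-- does not depend on k.  Hence the minimum over k ∈ ℤ is 0 or is attained in
-- the window; symmetrically for the maximum of the sums over t ≤ k.

-- Opaque only to keep the type checker from unfolding these needlessly.
opaque
  εᴹ : ∀ {n} → Fin n → Laurent n → ℤ
  εᴹ i m = - foldr ℤ._⊓_ 0ℤ (map (sum≥ m i) (window (bound m)))

  φᴹ : ∀ {n} → Fin n → Laurent n → ℤ
  φᴹ i m = foldr ℤ._⊔_ 0ℤ (map (sum≤ m i) (window (bound m)))

  -- When εᴹ i m > 0 (resp. φᴹ i m > 0), the only case in which these are used,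
  -- the extremal k lies in the window; the default value is an end point of it.

  kₑ : ∀ {n} → Fin n → Laurent n → ℤ
  kₑ i m = foldr ℤ._⊔_ (- (+ bound m))
             (filter (λ k → εᴹ i m ℤ.≟ - sum≥ m i k) (window (bound m)))

  k_f : ∀ {n} → Fin n → Laurent n → ℤ
  k_f i m = foldr ℤ._⊓_ (+ bound m)
              (filter (λ k → φᴹ i m ℤ.≟ sum≤ m i k) (window (bound m)))

Y : ∀ {n} → Fin n → ℤ → Laurent n
Y = var

module _ {n : ℕ} .{{_ : NonZero n}} where

  A : Fin n → ℤ → Laurent n
  A i k = Y i k · Y i (k + 1ℤ) · Y (prev i) (k + 1ℤ) ⁻¹ · Y (next i) k ⁻¹

  eᴹ : Fin n → Laurent n → Maybe (Laurent n)
  eᴹ i m = unless (does (εᴹ i m ℤ.≟ 0ℤ)) (m · A i (kₑ i m - 1ℤ))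

  fᴹ : Fin n → Laurent n → Maybe (Laurent n)
  fᴹ i m = unless (does (φᴹ i m ℤ.≟ 0ℤ)) (m · A i (k_f i m) ⁻¹)

  X : Fin n → ℤ → Laurent n
  X i k = Y (prev i) (k + 1ℤ) ⁻¹ · Y i k

  -- Here x is read as a monomial in the X i k, and toY x is its expansion
  -- ∏ (X i k)^{x i k} in the variables Y: the variable Y i k occurs in X i k
  -- with exponent 1, in X (next i) (k - 1) with exponent -1, and in no other.
  -- See toY-var, toY-one, toY-· and toY-⁻¹.
  toY : Laurent n → Laurent n
  toY x .exponent i k    = exponent x i k - exponent x (next i) (k - 1ℤ)
  toY x .bound           = suc (bound x)
  toY x .vanishes i k lt = cong₂ _-_
    (vanishes x i k (ℕₚ.<-trans (ℕₚ.n<1+n _) lt))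
    (vanishes x (next i) (k - 1ℤ) (ℕₚ.+-cancelʳ-< 1 _ _ (shift k lt)))
    where
    shift : ∀ k → suc (bound x) ℕ.< ∣ k ∣ → bound x ℕ.+ 1 ℕ.< ∣ k - 1ℤ ∣ ℕ.+ 1
    shift k lt = begin-strict
      bound x ℕ.+ 1      ≡⟨ ℕₚ.+-comm (bound x) 1 ⟩
      suc (bound x)      <⟨ lt ⟩
      ∣ k ∣              ≡⟨ cong ∣_∣ (k≡k-1+1 k) ⟩
      ∣ k - 1ℤ + 1ℤ ∣    ≤⟨ ℤₚ.∣i+j∣≤∣i∣+∣j∣ (k - 1ℤ) 1ℤ ⟩
      ∣ k - 1ℤ ∣ ℕ.+ 1   ∎
      where
      open ℕₚ.≤-Reasoning
      k≡k-1+1 : ∀ k → k ≡ k - 1ℤ + 1ℤ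
      k≡k-1+1 = solve-∀

  toY-one : toY one ≋ one
  toY-one i k = refl

  toY-· : ∀ x x′ → toY (x · x′) ≋ toY x · toY x′
  toY-· x x′ i k = lem (exponent x i k) (exponent x′ i k) _ _
    where
    lem : ∀ a b c d → (a + b) - (c + d) ≡ (a - c) + (b - d)
    lem = solve-∀

  toY-⁻¹ : ∀ x → toY (x ⁻¹) ≋ toY x ⁻¹
  toY-⁻¹ x i k = lem (exponent x i k) _
    where
    lem : ∀ a c → - a - - c ≡ - (a - c)
    lem = solve-∀

  toY-var : ∀ i k → toY (var i k) ≋ X i k
  toY-var i k j l = begin
    δ i k j l - δ i k (next j) (l - 1ℤ)        ≡⟨ cong (_-_ (δ i k j l)) δ-shift ⟩
    δ i k j l - δ (prev i) (k + 1ℤ) j l        ≡⟨ ℤₚ.+-comm (δ i k j l) _ ⟩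
    - δ (prev i) (k + 1ℤ) j l + δ i k j l      ∎
    where
    open ≡-Reasoning
    minus-plus : ∀ a → a - 1ℤ + 1ℤ ≡ a
    minus-plus = solve-∀
    plus-minus : ∀ a → a + 1ℤ - 1ℤ ≡ a
    plus-minus = solve-∀
    δ-shift : δ i k (next j) (l - 1ℤ) ≡ δ (prev i) (k + 1ℤ) j l
    δ-shift = cong₂ (λ a b → if a ∧ b then 1ℤ else 0ℤ)
      (does-⇔ (mk⇔ (λ p → trans (cong prev p) (prev-next j)) (λ p → trans (sym (next-prev i)) (cong next p)))
              (i Fin.≟ next j) (prev i Fin.≟ j))
      (does-⇔ (mk⇔ (λ p → trans (cong (_+ 1ℤ) p) (minus-plus l)) (λ p → trans (sym (plus-minus k)) (cong (_- 1ℤ) p)))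
              (k ℤ.≟ l - 1ℤ) (k + 1ℤ ℤ.≟ l))

  -- The X i k being multiplicatively independent, the expression of m in the
  -- X i k is unique up to _≋_.
  record InX (m : Laurent n) : Set where
    constructor inX
    field
      expression : Laurent n
      expands    : toY expression ≋ m
  open InX public

  InX-· : ∀ {m m′} → InX m → InX m′ → InX (m · m′)
  InX-· (inX x p) (inX x′ p′) = inX (x · x′) λ i k → trans (toY-· x x′ i k) (cong₂ _+_ (p i k) (p′ i k))

  InX-⁻¹ : ∀ {m} → InX m → InX (m ⁻¹)
  InX-⁻¹ (inX x p) = inX (x ⁻¹) λ i k → trans (toY-⁻¹ x i k) (cong -_ (p i k))

  InX-X : ∀ i k → InX (X i k)
  InX-X i k = inX (var i k) (toY-var i k)

  -- A i k = X i k · X (i + 1) k ⁻¹.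
  InX-A : ∀ i k → InX (A i k)
  InX-A i k = inX (expression q) λ j l → trans (expands q j l) (lem j l)
    where
    q : InX (X i k · X (next i) k ⁻¹)
    q = InX-· (InX-X i k) (InX-⁻¹ (InX-X (next i) k))
    rearrange : ∀ a b c d → (- a + b) + - (- c + d) ≡ b + c + - a + - d
    rearrange = solve-∀
    lem : X i k · X (next i) k ⁻¹ ≋ A i k
    lem j l = trans
      (cong (λ h → (- a + b) + - (- δ h (k + 1ℤ) j l + d)) (prev-next i))
      (rearrange a b (δ i (k + 1ℤ) j l) d)
      where
      a = δ (prev i) (k + 1ℤ) j l
      b = δ i k j l
      d = δ (next i) k j l

  InX-eᴹ : ∀ i {m m′} → InX m → eᴹ i m ≡ just m′ → InX m′
  InX-eᴹ i {m} p eq =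
    subst InX (unless-just (does (εᴹ i m ℤ.≟ 0ℤ)) eq) (InX-· p (InX-A i (kₑ i m - 1ℤ)))

  InX-fᴹ : ∀ i {m m′} → InX m → fᴹ i m ≡ just m′ → InX m′
  InX-fᴹ i {m} p eq =
    subst InX (unless-just (does (φᴹ i m ℤ.≟ 0ℤ)) eq) (InX-· p (InX-⁻¹ (InX-A i (k_f i m))))

------------------------------------------------------------------------

SquareFree : ∀ {n} → Laurent n → Set
SquareFree x = ∀ j l → ¬ (+ 2 ℤ.≤ exponent x j l)

squareFree? : ∀ {n} (x : Laurent n) → Dec (SquareFree x)
squareFree? x = Finₚ.all? λ j → mapDec (everywhere j) (λ sf → All.tabulate λ {l} _ → sf l)
  (All.all? (λ l → ¬? (+ 2 ℤ.≤? exponent x j l)) (window (bound x)))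
  where
  everywhere : ∀ j → All (λ l → ¬ (+ 2 ℤ.≤ exponent x j l)) (window (bound x)) →
               ∀ l → ¬ (+ 2 ℤ.≤ exponent x j l)
  everywhere j sf l with ∣ l ∣ ℕ.≤? bound x
  ... | yes le = All.lookup sf (∈-window l le)
  ... | no ¬le rewrite vanishes x j l (ℕₚ.≰⇒> ¬le) = λ { (ℤ.+≤+ ()) }

module _ {n : ℕ} .{{_ : NonZero n}} where

  -- Nakajima monomials that are monomials in the X i k.
  XMonomial : Set
  XMonomial = Σ (Laurent n) InX

  dropSquares : XMonomial → Maybe XMonomial
  dropSquares (m , p) = if does (squareFree? (expression p)) then just (m , p) else nothing

  ē : Fin n → XMonomial → Maybe XMonomial
  ē i (m , p) = attach (eᴹ i m) (InX-eᴹ i p) Maybe.>>= dropSquares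

  f̄ : Fin n → XMonomial → Maybe XMonomial
  f̄ i (m , p) = attach (fᴹ i m) (InX-fᴹ i p) Maybe.>>= dropSquares

  data Closure (m : XMonomial) : XMonomial → Set where
    base   : Closure m m
    step-ē : ∀ i {m′ m″} → Closure m m′ → ē i m′ ≡ just m″ → Closure m m″
    step-f̄ : ∀ i {m′ m″} → Closure m m′ → f̄ i m′ ≡ just m″ → Closure m m″

  -- Each application of ē i (resp. f̄ i) is one of eᴹ i (resp. fᴹ i), which
  -- lowers εᴹ i (resp. φᴹ i) by one; so the fuel below bounds the string
  -- lengths.
  M̄ : XMonomial → PreCrystal n
  M̄ m = record
    { setoid = On.setoid (laurentSetoid n) (proj₁ ∘ proj₁)
    ; wt     = λ ((m′ , _) , _) → wtᴹ m′
    ; ε      = λ i b@((m′ , _) , _) → + stringLength ∣ εᴹ i m′ ∣ (e i) b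
    ; φ      = λ i b@((m′ , _) , _) → + stringLength ∣ φᴹ i m′ ∣ (f i) b
    ; e      = e
    ; f      = f
    }
    where
    e f : Fin n → Σ XMonomial (Closure m) → Maybe (Σ XMonomial (Closure m))
    e i (m′ , c) = attach (ē i m′) (step-ē i c)
    f i (m′ , c) = attach (f̄ i m′) (step-f̄ i c)

  ∏X : ℕ → ℤ → XMonomial
  ∏X zero    k = one , inX one toY-one
  ∏X (suc r) k = proj₁ (∏X r k) · X (suc r mod n) k , InX-· (proj₂ (∏X r k)) (InX-X (suc r mod n) k)

------------------------------------------------------------------------
-- A vector in {0,1}ⁿ is a Subset n
-- whose position i ∈ Fin n holds xᵢ (so position 0 holds x₀ = xₙ).

move : ∀ {n} → Fin n → Fin n → Subset n → Maybe (Subset n)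
move a b x = if lookup x a ∧ not (lookup x b)
             then just (x [ a ]≔ false [ b ]≔ true) else nothing

private
  ∣set-true∣ : ∀ {n} (x : Subset n) a → lookup x a ≡ false →
               Subset.∣ x [ a ]≔ true ∣ ≡ suc Subset.∣ x ∣
  ∣set-true∣ (false ∷ x) Fin.zero    eq = refl
  ∣set-true∣ (true  ∷ x) (Fin.suc a) eq = cong suc (∣set-true∣ x a eq)
  ∣set-true∣ (false ∷ x) (Fin.suc a) eq = ∣set-true∣ x a eq

  ∣set-false-true∣ : ∀ {n} (x : Subset n) a b → lookup x a ≡ true → lookup x b ≡ false →
                     Subset.∣ x [ a ]≔ false [ b ]≔ true ∣ ≡ Subset.∣ x ∣
  ∣set-false-true∣ (true  ∷ x) Fin.zero    Fin.zero    p ()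
  ∣set-false-true∣ (true  ∷ x) Fin.zero    (Fin.suc b) p q = ∣set-true∣ x b q
  ∣set-false-true∣ (false ∷ x) (Fin.suc a) Fin.zero    p q = lower x a p
    where
    lower : ∀ {n} (x : Subset n) a → lookup x a ≡ true →
            suc Subset.∣ x [ a ]≔ false ∣ ≡ Subset.∣ x ∣
    lower (true  ∷ x) Fin.zero    eq = refl
    lower (true  ∷ x) (Fin.suc a) eq = cong suc (lower x a eq)
    lower (false ∷ x) (Fin.suc a) eq = lower x a eq
  ∣set-false-true∣ (true  ∷ x) (Fin.suc a) (Fin.suc b) p q = cong suc (∣set-false-true∣ x a b p q)
  ∣set-false-true∣ (false ∷ x) (Fin.suc a) (Fin.suc b) p q = ∣set-false-true∣ x a b p q

∣move∣ : ∀ {n} a b (x : Subset n) {x′} → move a b x ≡ just x′ → Subset.∣ x′ ∣ ≡ Subset.∣ x ∣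
∣move∣ a b x eq with lookup x a in p | lookup x b in q
∣move∣ a b x refl | true | false = ∣set-false-true∣ x a b p q

module _ (n : ℕ) .{{_ : NonZero n}} (r : ℕ) where

  KR-Carrier : Set
  KR-Carrier = Σ[ x ∈ Subset n ] Subset.∣ x ∣ ≡ r

  -- After a move from a to b no further one is possible, whence the fuel 1.
  KR : PreCrystal n
  KR = record
    { setoid = On.setoid (≡-setoid (Subset n)) (proj₁ {B = λ x → Subset.∣ x ∣ ≡ r})
    ; wt     = λ (x , _) i → coord x i - coord x (next i)
    ; ε      = λ i b → + stringLength 1 (e i) b
    ; φ      = λ i b → + stringLength 1 (f i) b
    ; e      = e
    ; f      = f
    }
    where
    coord : Subset n → Fin n → ℤ
    coord x i = if lookup x i then 1ℤ else 0ℤ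

    e f : Fin n → KR-Carrier → Maybe KR-Carrier
    e i (x , c) = attach (move (next i) i x) (λ eq → trans (∣move∣ (next i) i x eq) c)
    f i (x , c) = attach (move i (next i) x) (λ eq → trans (∣move∣ i (next i) x eq) c)

{-# OPTIONS --safe #-}

-- The subset x of I, of cardinality r, corresponds to the monomial
-- ∏_{xᵢ = 1} X i k, all at the level k of the initial monomial.  Its Yᵢ-part is
-- Y i k ^ xᵢ · Y i (k + 1) ^ (- xᵢ₊₁), whence εᴹ i = xᵢ₊₁, φᴹ i = xᵢ, kₑ = k + 1 and
-- k_f = k: so fᵢ multiplies by A i k ⁻¹ = X i k ⁻¹ · X (i + 1) k and eᵢ by its
-- inverse, which moves a particle between i and i + 1 without leaving level k.
-- The square-free condition excludes exactly the moves to an occupied place.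
-- Every subset is reached because the bits of a vector can be sorted by
-- adjacent transpositions.

module Submission where

open import Defs
open import Data.Bool using (Bool; true; false; if_then_else_; _∧_; not)
open import Data.Bool.Properties using (¬-not)
open import Data.Empty using (⊥)
open import Data.Fin as Fin using (Fin; toℕ)
import Data.Fin.Properties as Finₚ
open import Data.Fin.Subset as Subset using (Subset; ∣_∣)
open import Data.Fin.Subset.Properties using (∣⊥∣≡0)
open import Data.Integer as ℤ using (ℤ; +_; -[1+_]; 0ℤ; 1ℤ; _+_; _-_; -_)
import Data.Integer.Properties as ℤₚ
open import Data.Integer.Tactic.RingSolver using (solve-∀)
open import Data.List using (List; []; _∷_; map; foldr; upTo; filter)
open import Data.List.Membership.Propositional using (_∈_)
open import Data.List.Membership.Propositional.Properties using (∈-map⁺; ∈-map⁻; ∈-filter⁺; ∈-filter⁻)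
open import Data.List.Properties using (map-cong; foldr-preservesᵇ; foldr-preservesᵒ)
open import Data.List.Relation.Unary.All as All using (All; []; _∷_)
import Data.List.Relation.Unary.All.Properties as Allₚ
open import Data.List.Relation.Unary.Any as Any using (here; there)
open import Data.List.Relation.Unary.Unique.Propositional using (Unique; []; _∷_)
import Data.List.Relation.Unary.Unique.Propositional.Properties as Uniqueₚ
open import Data.Maybe as Maybe using (Maybe; just; nothing; maybe′; is-just; Is-just)
open import Data.Maybe.Relation.Binary.Pointwise as Pointwise using (Pointwise; just; nothing; just-inv)
open import Data.Maybe.Relation.Unary.Any using (just)
open import Data.Nat using (ℕ; zero; suc; NonZero; _≤_; _<_; z≤n; s≤s)
open import Data.Nat.DivMod using (_mod_; _%_; m<n⇒m%n≡m; n%n≡0)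
import Data.Nat.Properties as ℕₚ
open import Data.Product using (Σ; ∃; ∃₂; _×_; _,_; proj₁; proj₂)
open import Data.Sum as Sum using (_⊎_; inj₁; inj₂)
open import Data.Vec using (_∷_; []; lookup; _[_]≔_)
open import Data.Vec.Properties
  using (lookup∘update; lookup∘update′; []≔-commutes; []≔-idempotent; []≔-lookup;
         lookup-replicate; tabulate∘lookup; tabulate-cong)
open import Function using (_∘_; _⇔_; mk⇔; Equivalence)
open import Relation.Binary.Bundles using (module Setoid)
open import Relation.Binary.Construct.Closure.ReflexiveTransitive
  using (Star; ε; _◅_; _◅◅_; gmap; reverse; fold)
open import Relation.Binary.PropositionalEquality hiding (setoid)
open import Relation.Nullary using (¬_; Dec; yes; no; does; contradiction)
open import Relation.Nullary.Decidable using (does-⇔; dec-true; dec-false)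

-- Partial operators

-- An element of `M̄` is a monomial with a chosen expression in the `X` and a derivation in
-- `Closure`, so a subset has many representatives and no canonical one. The link is therefore a
-- relation, `Represents`, imposed on the stored expression because that is what `dropSquares`
-- inspects. Once the operators on both sides respect it, the crystal axioms and regularity need to
-- be verified on 0/1 vectors only; both pass to `M̄` along with the isomorphism. The unmodified
-- `εᴹ` and `φᴹ` are not the string lengths of the modified operators: if xᵢ = xᵢ₊₁ = 1, both equal
-- 1 although `ē i` and `f̄ i` vanish. They enter the crystal only as fuel, which must be compared
-- with the fuel 1 of `KR`.

private variable
  n : ℕ
  S T : Set

is-just-false : (o : Maybe S) → is-just o ≡ false → o ≡ nothing
is-just-false nothing _ = refl

is-just-attach : {P : S → Set} (o : Maybe S) (p : ∀ {a} → o ≡ just a → P a) →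
                 is-just (attach {P = P} o p) ≡ is-just o
is-just-attach (just _) p = refl
is-just-attach nothing  p = refl

attach-just⇔ : {P : S → Set} (o : Maybe S) (p : ∀ {a} → o ≡ just a → P a) {b : Σ S P} →
               Pointwise (λ x y → proj₁ x ≡ proj₁ y) (attach o p) (just b) ⇔ o ≡ just (proj₁ b)
attach-just⇔ (just a) p = mk⇔ (λ { (just eq) → cong just eq }) (λ { refl → just refl })
attach-just⇔ nothing  p = mk⇔ (λ ()) (λ ())

attach⁺ : {P : S → Set} {Q : T → Set} {R : S → T → Set} {o : Maybe S} {o′ : Maybe T} →
          Pointwise R o o′ →
          (p : ∀ {a} → o ≡ just a → P a) (q : ∀ {a} → o′ ≡ just a → Q a) →
          Pointwise (λ x y → R (proj₁ x) (proj₁ y)) (attach o p) (attach o′ q)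
attach⁺ (just r) p q = just r
attach⁺ nothing  p q = nothing

bit : Bool → ℤ
bit b = if b then 1ℤ else 0ℤ

stringLength₁ : (op : S → Maybe S) (b : S) → + stringLength 1 op b ≡ bit (is-just (op b))
stringLength₁ op b with op b
... | just _  = refl
... | nothing = refl

-- Fuel 1 is enough because `stop` ends every string after one step; the two cases of `go` are the
-- strings of length 0 and 1.
isStringLength₁ : (op : S → Maybe S) (b : S) → (∀ {b′} → op b ≡ just b′ → op b′ ≡ nothing) →
                  IsStringLength op b (+ stringLength 1 op b)
isStringLength₁ op b stop = go (op b) refl
  where
  go : ∀ o → op b ≡ o → IsStringLength op b (+ maybe′ (λ _ → 1) 0 o)
  go nothing eq = 0 , refl , just _ , bounded
    where
    bounded : ∀ q → Is-just (iterate op q b) → q ≤ 0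
    bounded zero    _  = z≤n
    bounded (suc q) ij with subst (λ o → Is-just (o Maybe.>>= iterate op q)) eq ij
    ... | ()
  go (just b′) eq = 1 , refl , subst (λ o → Is-just (o Maybe.>>= just)) (sym eq) (just _) , bounded
    where
    bounded : ∀ q → Is-just (iterate op q b) → q ≤ 1
    bounded zero          _  = z≤n
    bounded (suc zero)    _  = s≤s z≤n
    bounded (suc (suc q)) ij
      with subst (λ o → Is-just (o Maybe.>>= iterate op q)) (stop eq)
             (subst (λ o → Is-just (o Maybe.>>= iterate op (suc q))) eq ij)
    ... | ()

-- Moving a particle

is-just-move : ∀ a b (x : Subset n) → is-just (move a b x) ≡ lookup x a ∧ not (lookup x b)
is-just-move a b x with lookup x a ∧ not (lookup x b)
... | true  = refl
... | false = refl

move-just : ∀ a b (x : Subset n) → lookup x a ≡ true → lookup x b ≡ false →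
            move a b x ≡ just (x [ a ]≔ false [ b ]≔ true)
move-just a b x p q rewrite p | q = refl

move-nothing : ∀ a b (x : Subset n) → lookup x a ∧ not (lookup x b) ≡ false → move a b x ≡ nothing
move-nothing a b x eq rewrite eq = refl

move⁻ : ∀ a b (x : Subset n) {x′} → move a b x ≡ just x′ →
        lookup x a ≡ true × lookup x b ≡ false × x′ ≡ x [ a ]≔ false [ b ]≔ true
move⁻ a b x eq with lookup x a | lookup x b
move⁻ a b x refl | true | false = refl , refl , refl

lookup-move-source : ∀ {a b} (x : Subset n) {x′} → a ≢ b → move a b x ≡ just x′ → lookup x′ a ≡ false
lookup-move-source {a = a} {b} x a≢b eq with _ , _ , refl ← move⁻ a b x eq =
  trans (lookup∘update′ a≢b (x [ a ]≔ false) true) (lookup∘update a x false)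

lookup-move-target : ∀ {a b} (x : Subset n) {x′} → move a b x ≡ just x′ → lookup x′ b ≡ true
lookup-move-target {a = a} {b} x eq with _ , _ , refl ← move⁻ a b x eq =
  lookup∘update b (x [ a ]≔ false) true

-- Writes at distinct places commute, so each place ends up overwritten with the value it had in
-- `x`.
move-inverse : ∀ {a b} (x : Subset n) {x′} → a ≢ b → move a b x ≡ just x′ → move b a x′ ≡ just x
move-inverse {a = a} {b} x {x′} a≢b eq with move⁻ a b x eq
... | xa , xb , refl = trans
  (move-just b a x′ (lookup-move-target x eq) (lookup-move-source x a≢b eq))
  (cong just (begin
    x [ a ]≔ false [ b ]≔ true [ b ]≔ false [ a ]≔ true
      ≡⟨ cong (_[ a ]≔ true) ([]≔-idempotent (x [ a ]≔ false) b) ⟩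
    x [ a ]≔ false [ b ]≔ false [ a ]≔ true
      ≡⟨ cong (_[ a ]≔ true) ([]≔-commutes x a b a≢b) ⟩
    x [ b ]≔ false [ a ]≔ false [ a ]≔ true
      ≡⟨ []≔-idempotent (x [ b ]≔ false) a ⟩
    x [ b ]≔ false [ a ]≔ true
      ≡⟨ cong (λ y → y [ a ]≔ true) (trans (cong (x [ b ]≔_) (sym xb)) ([]≔-lookup x b)) ⟩
    x [ a ]≔ true
      ≡⟨ trans (cong (x [ a ]≔_) (sym xa)) ([]≔-lookup x a) ⟩
    x ∎))
  where open ≡-Reasoning

-- Coordinates under a move, and arithmetic of cyclic indices

coord : Subset n → Fin n → ℤ
coord x i = bit (lookup x i)

coord-set-true : ∀ (x : Subset n) a → lookup x a ≡ false → ∀ j → coord (x [ a ]≔ true) j ≡ coord x j + Λ a j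
coord-set-true x a xa j with a Fin.≟ j
... | yes refl rewrite lookup∘update a x true | xa = refl
... | no  a≢j  rewrite lookup∘update′ (a≢j ∘ sym) x true = sym (ℤₚ.+-identityʳ _)

-- Both changes are instances of filling an empty place: `x` and the result arise from the same
-- vector `y`, emptied at `a`, by filling `a` and `b` respectively.
coord-move : ∀ {a b} (x : Subset n) {x′} → a ≢ b → move a b x ≡ just x′ →
             ∀ j → coord x′ j ≡ coord x j - Λ a j + Λ b j
coord-move {a = a} {b} x a≢b eq j with move⁻ a b x eq
... | xa , xb , refl = begin
  coord (y [ b ]≔ true) j          ≡⟨ coord-set-true y b yb j ⟩
  coord y j + Λ b j                ≡⟨ cong (_+ Λ b j) (cancel (coord y j) (Λ a j)) ⟨
  coord y j + Λ a j - Λ a j + Λ b j ≡⟨ cong (λ c → c - Λ a j + Λ b j)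
                                           (coord-set-true y a (lookup∘update a x false) j) ⟨
  coord (y [ a ]≔ true) j - Λ a j + Λ b j ≡⟨ cong (λ z → coord z j - Λ a j + Λ b j) y[a]≡x ⟩
  coord x j - Λ a j + Λ b j ∎
  where
  open ≡-Reasoning
  y = x [ a ]≔ false
  yb : lookup y b ≡ false
  yb = trans (lookup∘update′ (a≢b ∘ sym) x false) xb
  y[a]≡x : y [ a ]≔ true ≡ x
  y[a]≡x = trans ([]≔-idempotent x a) (trans (cong (x [ a ]≔_) (sym xa)) ([]≔-lookup x a))
  cancel : ∀ c d → c + d - d ≡ c
  cancel = solve-∀

∣set-true∣ : ∀ (x : Subset n) a → lookup x a ≡ false → ∣ x [ a ]≔ true ∣ ≡ suc ∣ x ∣
∣set-true∣ (false ∷ x) Fin.zero    eq = refl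
∣set-true∣ (true  ∷ x) (Fin.suc a) eq = cong suc (∣set-true∣ x a eq)
∣set-true∣ (false ∷ x) (Fin.suc a) eq = ∣set-true∣ x a eq

toℕ-mod : ∀ {a n} .{{_ : NonZero n}} → a < n → toℕ (a mod n) ≡ a
toℕ-mod a<n = trans (Finₚ.toℕ-fromℕ< _) (m<n⇒m%n≡m a<n)

-- Either the successor does not wrap around and is larger, or `i` is the last index and its
-- successor is 0; equality would then force `n` to be 1.
i≢next : .{{_ : NonZero n}} → 1 < n → (i : Fin n) → i ≢ next i
i≢next {n} 1<n i eq with ℕₚ.m≤n⇒m<n∨m≡n (Finₚ.toℕ<n i)
... | inj₁ si<n = ℕₚ.1+n≢n (sym (trans (cong toℕ eq) (toℕ-mod si<n)))
... | inj₂ si≡n = contradiction (subst (1 <_) (trans (sym si≡n) (cong suc toℕi≡0)) 1<n) (ℕₚ.<-irrefl refl)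
  where
  toℕi≡0 : toℕ i ≡ 0
  toℕi≡0 = trans (cong toℕ eq) (trans (Finₚ.toℕ-fromℕ< _) (trans (cong (_% n) si≡n) (n%n≡0 n)))

Λ-next : .{{_ : NonZero n}} (i j : Fin n) → Λ i (next j) ≡ Λ (prev i) j
Λ-next i j = cong bit (does-⇔
  (mk⇔ (λ p → trans (cong prev p) (prev-next j)) (λ p → trans (sym (next-prev i)) (cong next p)))
  (i Fin.≟ next j) (prev i Fin.≟ j))

-- The Kirillov–Reshetikhin crystal

module _ .{{_ : NonZero n}} (1<n : 1 < n) (r : ℕ) where
  private
    module B = PreCrystal (KR n r)

    i≢i+1 : (i : Fin n) → i ≢ next i
    i≢i+1 = i≢next 1<n

    i+1≢i : (i : Fin n) → next i ≢ i
    i+1≢i i = i≢i+1 i ∘ sym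

  is-just-KR-e : ∀ i b → is-just (B.e i b) ≡ lookup (proj₁ b) (next i) ∧ not (lookup (proj₁ b) i)
  is-just-KR-e i (x , c) = trans (is-just-attach (move (next i) i x) _) (is-just-move (next i) i x)

  is-just-KR-f : ∀ i b → is-just (B.f i b) ≡ lookup (proj₁ b) i ∧ not (lookup (proj₁ b) (next i))
  is-just-KR-f i (x , c) = trans (is-just-attach (move i (next i) x) _) (is-just-move i (next i) x)

  KR-ε : ∀ i b → B.ε i b ≡ bit (lookup (proj₁ b) (next i) ∧ not (lookup (proj₁ b) i))
  KR-ε i b = trans (stringLength₁ (B.e i) b) (cong bit (is-just-KR-e i b))

  KR-φ : ∀ i b → B.φ i b ≡ bit (lookup (proj₁ b) i ∧ not (lookup (proj₁ b) (next i)))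
  KR-φ i b = trans (stringLength₁ (B.f i) b) (cong bit (is-just-KR-f i b))

  KR-e⇔ : ∀ i b b′ → (B.e i b B.≈? just b′) ⇔ move (next i) i (proj₁ b) ≡ just (proj₁ b′)
  KR-e⇔ i (x , _) b′ = attach-just⇔ (move (next i) i x) _

  KR-f⇔ : ∀ i b b′ → (B.f i b B.≈? just b′) ⇔ move i (next i) (proj₁ b) ≡ just (proj₁ b′)
  KR-f⇔ i (x , _) b′ = attach-just⇔ (move i (next i) x) _

  -- Reduces the axioms about `e` in `KR-isCrystal` to those about `f`, read backwards.
  KR-e⇒f : ∀ i {b b′} → B.e i b B.≈? just b′ → B.f i b′ B.≈? just b
  KR-e⇒f i {b} {b′} eb = KR-f⇔ i b′ b .Equivalence.from
    (move-inverse (proj₁ b) (i+1≢i i) (KR-e⇔ i b b′ .Equivalence.to eb))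

  KR-f⇒e : ∀ i {b b′} → B.f i b B.≈? just b′ → B.e i b′ B.≈? just b
  KR-f⇒e i {b} {b′} fb = KR-e⇔ i b′ b .Equivalence.from
    (move-inverse (proj₁ b) (i≢i+1 i) (KR-f⇔ i b b′ .Equivalence.to fb))

  private
    move-f : ∀ i {b b′} → B.f i b B.≈? just b′ → move i (next i) (proj₁ b) ≡ just (proj₁ b′)
    move-f i {b} {b′} = KR-f⇔ i b b′ .Equivalence.to

  -- The weight is a difference of neighbouring coordinates. The coordinate at `j` contributes
  -- `Λ (next i) j - Λ i j`; the one at `next j`, shifted back by `Λ-next`, contributes
  -- `Λ (prev i) j - Λ i j`. Together they make `- α i j`.
  KR-wt-f : ∀ i {b b′} → B.f i b B.≈? just b′ → ∀ j → B.wt b′ j ≡ B.wt b j - α i j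
  KR-wt-f i {b@(x , _)} {b′@(x′ , _)} fb j = begin
    coord x′ j - coord x′ (next j)
      ≡⟨ cong₂ _-_ (step j) (step (next j)) ⟩
    (coord x j - Λ i j + Λ (next i) j) - (coord x (next j) - Λ i (next j) + Λ (next i) (next j))
      ≡⟨ cong₂ (λ p q → (coord x j - Λ i j + Λ (next i) j) - (coord x (next j) - p + q))
           (Λ-next i j) (trans (Λ-next (next i) j) (cong (λ h → Λ h j) (prev-next i))) ⟩
    (coord x j - Λ i j + Λ (next i) j) - (coord x (next j) - Λ (prev i) j + Λ i j)
      ≡⟨ rearrange (coord x j) (coord x (next j)) (Λ i j) (Λ (prev i) j) (Λ (next i) j) ⟩
    coord x j - coord x (next j) - α i j ∎
    where
    open ≡-Reasoning
    step : ∀ j → coord x′ j ≡ coord x j - Λ i j + Λ (next i) j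
    step = coord-move x (i≢i+1 i) (move-f i {b} {b′} fb)
    rearrange : ∀ c d p q s → (c - p + s) - (d - q + p) ≡ c - d - (+ 2 ℤ.* p - q - s)
    rearrange = solve-∀

  private
    KR-ε-at : ∀ i b {p q} → lookup (proj₁ b) (next i) ≡ p → lookup (proj₁ b) i ≡ q → B.ε i b ≡ bit (p ∧ not q)
    KR-ε-at i b p q = trans (KR-ε i b) (cong₂ (λ p q → bit (p ∧ not q)) p q)

    KR-φ-at : ∀ i b {p q} → lookup (proj₁ b) i ≡ p → lookup (proj₁ b) (next i) ≡ q → B.φ i b ≡ bit (p ∧ not q)
    KR-φ-at i b p q = trans (KR-φ i b) (cong₂ (λ p q → bit (p ∧ not q)) p q)

  KR-ε-f : ∀ i {b b′} → B.f i b B.≈? just b′ → B.ε i b′ ≡ B.ε i b + 1ℤ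
  KR-ε-f i {b@(x , _)} {b′} fb =
    let mv = move-f i {b} {b′} fb
        xi , xi+1 , _ = move⁻ i (next i) x mv
    in trans (KR-ε-at i b′ (lookup-move-target x mv) (lookup-move-source x (i≢i+1 i) mv))
             (cong (_+ 1ℤ) (sym (KR-ε-at i b xi+1 xi)))

  KR-φ-f : ∀ i {b b′} → B.f i b B.≈? just b′ → B.φ i b′ ≡ B.φ i b - 1ℤ
  KR-φ-f i {b@(x , _)} {b′} fb =
    let mv = move-f i {b} {b′} fb
        xi , xi+1 , _ = move⁻ i (next i) x mv
    in trans (KR-φ-at i b′ (lookup-move-source x (i≢i+1 i) mv) (lookup-move-target x mv))
             (cong (_- 1ℤ) (sym (KR-φ-at i b xi xi+1)))

  private
    minus⇒plus : ∀ {a b} c → a ≡ b - c → b ≡ a + c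
    minus⇒plus {_} {b} c refl = lem b c
      where
      lem : ∀ b c → b ≡ b - c + c
      lem = solve-∀

    plus⇒minus : ∀ {a b} c → a ≡ b + c → b ≡ a - c
    plus⇒minus {_} {b} c refl = lem b c
      where
      lem : ∀ b c → b ≡ b + c - c
      lem = solve-∀

  KR-isCrystal : IsCrystal (KR n r)
  KR-isCrystal = record
    { wt-cong = λ { refl j → refl }
    ; ε-cong  = λ { i {b} {b′} refl → trans (KR-ε i b) (sym (KR-ε i b′)) }
    ; φ-cong  = λ { i {b} {b′} refl → trans (KR-φ i b) (sym (KR-φ i b′)) }
    ; e-cong  = λ { i {x , _} refl → attach⁺ (Pointwise.refl refl {move (next i) i x}) _ _ }
    ; f-cong  = λ { i {x , _} refl → attach⁺ (Pointwise.refl refl {move i (next i) x}) _ _ }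
    ; φ≡ε+wt  = φ≡ε+wt
    ; wt-e    = λ i {b} {b′} eb j → minus⇒plus (α i j) (KR-wt-f i {b′} {b} (KR-e⇒f i {b} {b′} eb) j)
    ; ε-e     = λ i {b} {b′} eb → plus⇒minus 1ℤ (KR-ε-f i {b′} {b} (KR-e⇒f i {b} {b′} eb))
    ; φ-e     = λ i {b} {b′} eb → minus⇒plus 1ℤ (KR-φ-f i {b′} {b} (KR-e⇒f i {b} {b′} eb))
    ; wt-f    = λ i {b} {b′} → KR-wt-f i {b} {b′}
    ; ε-f     = λ i {b} {b′} → KR-ε-f i {b} {b′}
    ; φ-f     = λ i {b} {b′} → KR-φ-f i {b} {b′}
    ; f⇔e     = λ i b b′ → mk⇔ (KR-f⇒e i {b} {b′}) (KR-e⇒f i {b′} {b})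
    }
    where
    φ≡ε+wt : ∀ i b → B.φ i b ≡ B.ε i b + B.wt b i
    φ≡ε+wt i b@(x , _) = begin
      B.φ i b                                              ≡⟨ KR-φ i b ⟩
      bit (lookup x i ∧ not (lookup x (next i)))           ≡⟨ balance (lookup x i) (lookup x (next i)) ⟩
      bit (lookup x (next i) ∧ not (lookup x i)) + B.wt b i ≡⟨ cong (_+ B.wt b i) (KR-ε i b) ⟨
      B.ε i b + B.wt b i                                   ∎
      where
      open ≡-Reasoning
      balance : ∀ p q → bit (p ∧ not q) ≡ bit (q ∧ not p) + (bit p - bit q)
      balance true  true  = refl
      balance true  false = refl
      balance false true  = refl
      balance false false = refl

  KR-isRegular : IsRegularCrystal (KR n r)
  KR-isRegular = record
    { isCrystal = KR-isCrystal
    -- A second step is impossible because the first one has emptied its source.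
    ; ε-regular = λ i b → isStringLength₁ (B.e i) b λ {b′} eb → is-just-false _
        (trans (is-just-KR-e i b′) (cong (_∧ not (lookup (proj₁ b′) i))
          (lookup-move-source (proj₁ b) (i+1≢i i)
            (KR-e⇔ i b b′ .Equivalence.to (Pointwise-≡ eb)))))
    ; φ-regular = λ i b → isStringLength₁ (B.f i) b λ {b′} fb → is-just-false _
        (trans (is-just-KR-f i b′) (cong (_∧ not (lookup (proj₁ b′) (next i)))
          (lookup-move-source (proj₁ b) (i≢i+1 i)
            (KR-f⇔ i b b′ .Equivalence.to (Pointwise-≡ fb)))))
    }
    where
    Pointwise-≡ : ∀ {o : Maybe B.Carrier} {b} → o ≡ just b → o B.≈? just b
    Pointwise-≡ refl = just refl

-- Transport of structure along a correspondence

-- The graph of an isomorphism up to the two equalities: the fields `R-≈ʳ` and `R-≈ˡ` say that it is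
-- well defined and injective. `Pointwise` in `R-e` and `R-f` also forces both operators to be 0 at
-- the same elements.
record Correspondence (B C : PreCrystal n) : Set₁ where
  private
    module B = PreCrystal B
    module C = PreCrystal C
  field
    R      : B.Carrier → C.Carrier → Set
    totalˡ : ∀ b → ∃ (R b)
    totalʳ : ∀ c → ∃ λ b → R b c
    R-≈ʳ   : ∀ {b b′ c c′} → R b c → R b′ c′ → b B.≈ b′ → c C.≈ c′
    R-≈ˡ   : ∀ {b b′ c c′} → R b c → R b′ c′ → c C.≈ c′ → b B.≈ b′
    R-wt   : ∀ {b c} → R b c → ∀ j → C.wt c j ≡ B.wt b j
    R-ε    : ∀ i {b c} → R b c → C.ε i c ≡ B.ε i b
    R-φ    : ∀ i {b c} → R b c → C.φ i c ≡ B.φ i b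
    R-e    : ∀ i {b c} → R b c → Pointwise R (B.e i b) (C.e i c)
    R-f    : ∀ i {b c} → R b c → Pointwise R (B.f i b) (C.f i c)

module _ {R : S → T → Set} {f : S → Maybe S} {g : T → Maybe T}
         (R-step : ∀ {b c} → R b c → Pointwise R (f b) (g c)) where

  iterate⁺ : ∀ p {b c} → R b c → Pointwise R (iterate f p b) (iterate g p c)
  iterate⁺ zero    r = just r
  iterate⁺ (suc p) {b} {c} r with f b | g c | R-step r
  ... | _ | _ | just r′ = iterate⁺ p r′
  ... | _ | _ | nothing = nothing

  stringLength⁺ : ∀ N {b c} → R b c → stringLength N f b ≡ stringLength N g c
  stringLength⁺ zero    r = refl
  stringLength⁺ (suc N) {b} {c} r with f b | g c | R-step r
  ... | _ | _ | just r′ = cong suc (stringLength⁺ N r′)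
  ... | _ | _ | nothing = refl

  isStringLength⁺ : ∀ {b c z} → R b c → IsStringLength f b z → IsStringLength g c z
  isStringLength⁺ {b} {c} r (p , z≡p , defined , bounded) =
    p , z≡p , to (iterate⁺ p r) defined , λ q ij → bounded q (from (iterate⁺ q r) ij)
    where
    to : ∀ {o o′} → Pointwise R o o′ → Is-just o → Is-just o′
    to (just _) _ = just _
    from : ∀ {o o′} → Pointwise R o o′ → Is-just o′ → Is-just o
    from (just _) _ = just _

module _ .{{_ : NonZero n}} {B C : PreCrystal n} (corr : Correspondence B C) where
  open Correspondence corr
  private
    module B = PreCrystal B
    module C = PreCrystal C

    to : B.Carrier → C.Carrier
    to b = proj₁ (totalˡ b)

    to-R : ∀ b → R b (to b)
    to-R b = proj₂ (totalˡ b)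

    liftʳ : ∀ {o o′ p p′} → Pointwise R o p → Pointwise R o′ p′ → o B.≈? o′ → p C.≈? p′
    liftʳ (just r) (just r′) (just eq) = just (R-≈ʳ r r′ eq)
    liftʳ nothing  nothing   nothing   = nothing

    liftˡ : ∀ {o o′ p p′} → Pointwise R o p → Pointwise R o′ p′ → p C.≈? p′ → o B.≈? o′
    liftˡ (just r) (just r′) (just eq) = just (R-≈ˡ r r′ eq)
    liftˡ nothing  nothing   nothing   = nothing

    ≈?-map : ∀ {o p} → Pointwise R o p → p C.≈? Maybe.map to o
    ≈?-map (just r) = just (R-≈ʳ r (to-R _) (Setoid.refl B.setoid))
    ≈?-map nothing  = nothing

  correspondence⇒≅ : B ≅ C
  correspondence⇒≅ = record
    { bijection = record
      { to        = to
      ; cong      = λ {b} {b′} → R-≈ʳ (to-R b) (to-R b′)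
      ; bijective = (λ {b} {b′} → R-≈ˡ (to-R b) (to-R b′))
                  , λ c → let b , r = totalʳ c in b , λ {b′} b′≈b → R-≈ʳ (to-R b′) r b′≈b
      }
    ; wt-pres = λ b → R-wt (to-R b)
    ; ε-pres  = λ i b → R-ε i (to-R b)
    ; φ-pres  = λ i b → R-φ i (to-R b)
    ; e-comm  = λ i b → ≈?-map (R-e i (to-R b))
    ; f-comm  = λ i b → ≈?-map (R-f i (to-R b))
    }

  -- Each axiom is pulled back to related elements of `B`: `liftˡ` carries an operator equation in
  -- `C` to `B`, and the `R-` fields carry the conclusion back.
  correspondence⇒isCrystal : IsCrystal B → IsCrystal C
  correspondence⇒isCrystal crystal = record
    { wt-cong = λ {c} {c′} eq j → let b , r = totalʳ c ; b′ , r′ = totalʳ c′ in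
        trans (R-wt r j) (trans (wt-cong (R-≈ˡ r r′ eq) j) (sym (R-wt r′ j)))
    ; ε-cong  = λ i {c} {c′} eq → let b , r = totalʳ c ; b′ , r′ = totalʳ c′ in
        trans (R-ε i r) (trans (ε-cong i (R-≈ˡ r r′ eq)) (sym (R-ε i r′)))
    ; φ-cong  = λ i {c} {c′} eq → let b , r = totalʳ c ; b′ , r′ = totalʳ c′ in
        trans (R-φ i r) (trans (φ-cong i (R-≈ˡ r r′ eq)) (sym (R-φ i r′)))
    ; e-cong  = λ i {c} {c′} eq → let b , r = totalʳ c ; b′ , r′ = totalʳ c′ in
        liftʳ (R-e i r) (R-e i r′) (e-cong i (R-≈ˡ r r′ eq))
    ; f-cong  = λ i {c} {c′} eq → let b , r = totalʳ c ; b′ , r′ = totalʳ c′ in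
        liftʳ (R-f i r) (R-f i r′) (f-cong i (R-≈ˡ r r′ eq))
    ; φ≡ε+wt  = λ i c → let b , r = totalʳ c in
        trans (R-φ i r) (trans (φ≡ε+wt i b) (cong₂ _+_ (sym (R-ε i r)) (sym (R-wt r i))))
    ; wt-e    = λ i {c} {c′} eq j → let b , r = totalʳ c ; b′ , r′ = totalʳ c′ in
        trans (R-wt r′ j) (trans (wt-e i (liftˡ (R-e i r) (just r′) eq) j) (cong (_+ α i j) (sym (R-wt r j))))
    ; ε-e     = λ i {c} {c′} eq → let b , r = totalʳ c ; b′ , r′ = totalʳ c′ in
        trans (R-ε i r′) (trans (ε-e i (liftˡ (R-e i r) (just r′) eq)) (cong (_- 1ℤ) (sym (R-ε i r))))
    ; φ-e     = λ i {c} {c′} eq → let b , r = totalʳ c ; b′ , r′ = totalʳ c′ in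
        trans (R-φ i r′) (trans (φ-e i (liftˡ (R-e i r) (just r′) eq)) (cong (_+ 1ℤ) (sym (R-φ i r))))
    ; wt-f    = λ i {c} {c′} eq j → let b , r = totalʳ c ; b′ , r′ = totalʳ c′ in
        trans (R-wt r′ j) (trans (wt-f i (liftˡ (R-f i r) (just r′) eq) j) (cong (_- α i j) (sym (R-wt r j))))
    ; ε-f     = λ i {c} {c′} eq → let b , r = totalʳ c ; b′ , r′ = totalʳ c′ in
        trans (R-ε i r′) (trans (ε-f i (liftˡ (R-f i r) (just r′) eq)) (cong (_+ 1ℤ) (sym (R-ε i r))))
    ; φ-f     = λ i {c} {c′} eq → let b , r = totalʳ c ; b′ , r′ = totalʳ c′ in
        trans (R-φ i r′) (trans (φ-f i (liftˡ (R-f i r) (just r′) eq)) (cong (_- 1ℤ) (sym (R-φ i r))))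
    ; f⇔e     = λ i c c′ → let b , r = totalʳ c ; b′ , r′ = totalʳ c′ in mk⇔
        (λ fc → liftʳ (R-e i r′) (just r) (f⇔e i b b′ .Equivalence.to (liftˡ (R-f i r) (just r′) fc)))
        (λ ec → liftʳ (R-f i r) (just r′) (f⇔e i b b′ .Equivalence.from (liftˡ (R-e i r′) (just r) ec)))
    }
    where open IsCrystal crystal

  correspondence⇒isRegular : IsRegularCrystal B → IsRegularCrystal C
  correspondence⇒isRegular regular = record
    { isCrystal = correspondence⇒isCrystal isCrystal
    ; ε-regular = λ i c → let b , r = totalʳ c in
        isStringLength⁺ (R-e i) r (subst (IsStringLength (B.e i) b) (sym (R-ε i r)) (ε-regular i b))
    ; φ-regular = λ i c → let b , r = totalʳ c in
        isStringLength⁺ (R-f i) r (subst (IsStringLength (B.f i) b) (sym (R-φ i r)) (φ-regular i b))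
    }
    where open IsRegularCrystal regular

-- Extrema and sums over the window

-- The start value counts as a candidate: a maximum of 0 is supplied by the default in `φᴹ`, and the
-- end-point default in `kₑ` only has to stay below the answer.
foldr-⊔ : ∀ {v z xs} → z ℤ.≤ v → All (ℤ._≤ v) xs → v ≡ z ⊎ v ∈ xs → foldr ℤ._⊔_ z xs ≡ v
foldr-⊔ {v} {z} {xs} z≤v xs≤v attained = ℤₚ.≤-antisym
  (foldr-preservesᵇ ℤₚ.⊔-lub z≤v xs≤v)
  (foldr-preservesᵒ {P = v ℤ.≤_} (λ x y → Sum.[ ℤₚ.i≤j⇒i≤j⊔k y , ℤₚ.i≤j⇒i≤k⊔j x ]) z xs
    (Sum.map ℤₚ.≤-reflexive (Any.map ℤₚ.≤-reflexive) attained))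

foldr-⊓ : ∀ {v z xs} → v ℤ.≤ z → All (v ℤ.≤_) xs → v ≡ z ⊎ v ∈ xs → foldr ℤ._⊓_ z xs ≡ v
foldr-⊓ {v} {z} {xs} v≤z v≤xs attained = ℤₚ.≤-antisym
  (foldr-preservesᵒ {P = ℤ._≤ v} (λ x y → Sum.[ ℤₚ.i≤j⇒i⊓k≤j y , ℤₚ.i≤j⇒k⊓i≤j x ]) z xs
    (Sum.map (ℤₚ.≤-reflexive ∘ sym) (Any.map (ℤₚ.≤-reflexive ∘ sym)) attained))
  (foldr-preservesᵇ ℤₚ.⊓-glb v≤z v≤xs)

-- Exponents concentrated at one level. With them, multiplying monomials is arithmetic in `u`
-- (`at-+`, `at-neg`) and changing level is arithmetic in `c` (`at-shift`).
at : ℤ → ℤ → ℤ → ℤ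
at c u t = if does (c ℤ.≟ t) then u else 0ℤ

at-self : ∀ c u → at c u c ≡ u
at-self c u rewrite dec-true (c ℤ.≟ c) refl = refl

at-other : ∀ {c t} u → c ≢ t → at c u t ≡ 0ℤ
at-other {c} {t} u c≢t rewrite dec-false (c ℤ.≟ t) c≢t = refl

∑ : (ℤ → ℤ) → List ℤ → ℤ
∑ g xs = foldr _+_ 0ℤ (map g xs)

∑-minus : ∀ g h xs → ∑ (λ t → g t - h t) xs ≡ ∑ g xs - ∑ h xs
∑-minus g h []       = refl
∑-minus g h (x ∷ xs) = trans (cong (_+_ (g x - h x)) (∑-minus g h xs)) (lem (g x) (h x) _ _)
  where
  lem : ∀ a b c d → a - b + (c - d) ≡ a + c - (b + d)
  lem = solve-∀

∑-at-∉ : ∀ {c xs} u → All (c ≢_) xs → ∑ (at c u) xs ≡ 0ℤ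
∑-at-∉ u []               = refl
∑-at-∉ u (c≢x ∷ c∉xs) = cong₂ _+_ (at-other u c≢x) (∑-at-∉ u c∉xs)

-- Uniqueness keeps `u` from being counted twice; `unique-window` provides it for the sums that
-- occur.
∑-at-∈ : ∀ {c xs} u → Unique xs → c ∈ xs → ∑ (at c u) xs ≡ u
∑-at-∈ {c} u (c∉xs ∷ _) (here refl) =
  trans (cong₂ _+_ (at-self c u) (∑-at-∉ u c∉xs)) (ℤₚ.+-identityʳ u)
∑-at-∈ u (x∉xs ∷ unique) (there c∈xs) =
  trans (cong₂ _+_ (at-other u (All.lookup x∉xs c∈xs ∘ sym)) (∑-at-∈ u unique c∈xs)) (ℤₚ.+-identityˡ u)

∑-at-0 : ∀ c xs → ∑ (at c 0ℤ) xs ≡ 0ℤ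
∑-at-0 c []       = refl
∑-at-0 c (x ∷ xs) with does (c ℤ.≟ x)
... | true  = trans (ℤₚ.+-identityˡ _) (∑-at-0 c xs)
... | false = trans (ℤₚ.+-identityˡ _) (∑-at-0 c xs)

unique-window : ∀ N → Unique (window N)
unique-window N = Uniqueₚ.++⁺
  (Uniqueₚ.map⁺ ℤₚ.+-injective (Uniqueₚ.upTo⁺ (suc N)))
  (Uniqueₚ.map⁺ ℤₚ.-[1+-injective (Uniqueₚ.upTo⁺ N))
  disjoint
  where
  disjoint : ∀ {t} → t ∈ map +_ (upTo (suc N)) × t ∈ map -[1+_] (upTo N) → ⊥
  disjoint (p , q) with ∈-map⁻ +_ p | ∈-map⁻ -[1+_] q
  ... | _ , _ , refl | _ , _ , ()

-- Bounds for partial sums with at most one term +1 and one term -1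

bit-≥0 : ∀ b → 0ℤ ℤ.≤ bit b
bit-≥0 true  = ℤ.+≤+ z≤n
bit-≥0 false = ℤ.+≤+ z≤n

mask : Bool → ℤ → ℤ
mask p u = if p then u else 0ℤ

mask-≥0 : ∀ p b → 0ℤ ℤ.≤ mask p (bit b)
mask-≥0 true  b = bit-≥0 b
mask-≥0 false b = ℤ.+≤+ z≤n

mask-≤ : ∀ p b → mask p (bit b) ℤ.≤ bit b
mask-≤ true  b = ℤₚ.≤-refl
mask-≤ false b = bit-≥0 b

mask-minus-≤ : ∀ p q a b → mask p (bit a) - mask q (bit b) ℤ.≤ bit a
mask-minus-≤ p q a b = ℤₚ.≤-trans
  (ℤₚ.+-mono-≤ (mask-≤ p a) (ℤₚ.neg-mono-≤ (mask-≥0 q b)))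
  (ℤₚ.≤-reflexive (ℤₚ.+-identityʳ (bit a)))

mask-minus-≥ : ∀ p q a b → - bit b ℤ.≤ mask p (bit a) - mask q (bit b)
mask-minus-≥ p q a b = ℤₚ.≤-trans
  (ℤₚ.≤-reflexive (sym (ℤₚ.+-identityˡ (- bit b))))
  (ℤₚ.+-mono-≤ (mask-≥0 p a) (ℤₚ.neg-mono-≤ (mask-≤ q b)))

-- For `k_f`: a partial sum can equal 1 only if it includes the positive term. The next lemma is the
-- counterpart for `kₑ` and the negative term.
mask-minus-≡1 : ∀ p q b → mask p 1ℤ - mask q (bit b) ≡ 1ℤ → p ≡ true
mask-minus-≡1 true  q     b     eq = refl
mask-minus-≡1 false true  true  ()
mask-minus-≡1 false true  false ()
mask-minus-≡1 false false b     ()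

mask-minus-≡-1 : ∀ p q a → - (mask p (bit a) - mask q 1ℤ) ≡ 1ℤ → q ≡ true
mask-minus-≡-1 p     true  a     eq = refl
mask-minus-≡-1 true  false true  ()
mask-minus-≡-1 true  false false ()
mask-minus-≡-1 false false a     ()

does-true⇒ : {P : Set} (p? : Dec P) → does p? ≡ true → P
does-true⇒ (yes p) _ = p

i≤∣i∣ : ∀ i → i ℤ.≤ + ℤ.∣ i ∣
i≤∣i∣ (+ _)      = ℤₚ.≤-refl
i≤∣i∣ -[1+ _ ]   = ℤ.-≤+

-∣i∣≤i : ∀ i → - (+ ℤ.∣ i ∣) ℤ.≤ i
-∣i∣≤i i = subst₂ ℤ._≤_ (cong (λ a → - (+ a)) (ℤₚ.∣-i∣≡∣i∣ i)) (ℤₚ.neg-involutive i)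
  (ℤₚ.neg-mono-≤ (i≤∣i∣ (- i)))

opaque
  unfolding εᴹ φᴹ kₑ k_f

  εᴹ-def : (i : Fin n) (m : Laurent n) →
           εᴹ i m ≡ - foldr ℤ._⊓_ 0ℤ (map (sum≥ m i) (window (bound m)))
  εᴹ-def i m = refl

  φᴹ-def : (i : Fin n) (m : Laurent n) →
           φᴹ i m ≡ foldr ℤ._⊔_ 0ℤ (map (sum≤ m i) (window (bound m)))
  φᴹ-def i m = refl

  kₑ-def : (i : Fin n) (m : Laurent n) →
           kₑ i m ≡ foldr ℤ._⊔_ (- (+ bound m))
                      (filter (λ k → εᴹ i m ℤ.≟ - sum≥ m i k) (window (bound m)))
  kₑ-def i m = refl

  k_f-def : (i : Fin n) (m : Laurent n) →
            k_f i m ≡ foldr ℤ._⊓_ (+ bound m)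
                        (filter (λ k → φᴹ i m ℤ.≟ sum≤ m i k) (window (bound m)))
  k_f-def i m = refl

-- For the monomial of a subset x, the profile has a = xᵢ and b = xᵢ₊₁.
module _ {m : Laurent n} {i : Fin n} (k : ℤ) (a b : Bool)
         (profile : ∀ t → exponent m i t ≡ at k (bit a) t - at (k + 1ℤ) (bit b) t) where
  private
    W : List ℤ
    W = window (bound m)

    k+1≢k : k + 1ℤ ≢ k
    k+1≢k eq = ℤₚ.i≢suc[i] (trans (sym eq) (ℤₚ.+-comm k 1ℤ))

    k+1≰k : ¬ (k + 1ℤ ℤ.≤ k)
    k+1≰k le = k+1≢k (ℤₚ.≤-antisym le (ℤₚ.i≤i+j k 1ℤ))

    -- `bound m` is an arbitrary witness of finiteness, unrelated to `k`. That `k` or `k + 1` lies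
    -- in the window can only be read off from a nonzero exponent there.
    support-bounded : ∀ t → exponent m i t ≢ 0ℤ → ℤ.∣ t ∣ ≤ bound m
    support-bounded t ≢0 = ℕₚ.≮⇒≥ (≢0 ∘ vanishes m i t)

    k-bounded : a ≡ true → ℤ.∣ k ∣ ≤ bound m
    k-bounded refl = support-bounded k λ eq → contradiction
      (trans (sym (trans (profile k) (cong₂ _-_ (at-self k 1ℤ) (at-other (bit b) k+1≢k)))) eq) λ ()

    k+1-bounded : b ≡ true → ℤ.∣ k + 1ℤ ∣ ≤ bound m
    k+1-bounded refl = support-bounded (k + 1ℤ) λ eq → contradiction
      (trans (sym (trans (profile (k + 1ℤ))
        (cong₂ _-_ (at-other (bit a) (k+1≢k ∘ sym)) (at-self (k + 1ℤ) 1ℤ)))) eq) λ ()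

    -- The bound on `c` is asked for only when the bit is set: a zero term may lie outside the
    -- window without affecting the sum.
    ∑-mask : ∀ c p d → (d ≡ true → ℤ.∣ c ∣ ≤ bound m) → ∑ (at c (mask p (bit d))) W ≡ mask p (bit d)
    ∑-mask c true  true  le = ∑-at-∈ 1ℤ (unique-window (bound m)) (∈-window c (le refl))
    ∑-mask c true  false le = ∑-at-0 c W
    ∑-mask c false d     le = ∑-at-0 c W

    mask-at : ∀ c d u v (cond : ℤ → Bool) t →
              mask (cond t) (at c u t - at d v t) ≡ at c (mask (cond c) u) t - at d (mask (cond d) v) t
    mask-at c d u v cond t with c ℤ.≟ t | d ℤ.≟ t
    mask-at c d u v cond t | yes refl | yes refl with cond t
    ... | true  = refl
    ... | false = refl
    mask-at c d u v cond t | yes refl | no _ with cond t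
    ... | true  = refl
    ... | false = refl
    mask-at c d u v cond t | no _ | yes refl with cond t
    ... | true  = refl
    ... | false = refl
    mask-at c d u v cond t | no _ | no _ with cond t
    ... | true  = refl
    ... | false = refl

  -- Stated for any condition so that the weight and both kinds of partial sums are instances.
  sumOver-profile : ∀ cond → sumOver m i cond ≡ mask (cond k) (bit a) - mask (cond (k + 1ℤ)) (bit b)
  sumOver-profile cond = begin
    sumOver m i cond
      ≡⟨ cong (foldr _+_ 0ℤ) (map-cong (λ t → trans (cong (mask (cond t)) (profile t))
           (mask-at k (k + 1ℤ) (bit a) (bit b) cond t)) W) ⟩
    ∑ (λ t → at k (mask (cond k) (bit a)) t - at (k + 1ℤ) (mask (cond (k + 1ℤ)) (bit b)) t) W
      ≡⟨ ∑-minus (at k (mask (cond k) (bit a))) (at (k + 1ℤ) (mask (cond (k + 1ℤ)) (bit b))) W ⟩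
    ∑ (at k (mask (cond k) (bit a))) W - ∑ (at (k + 1ℤ) (mask (cond (k + 1ℤ)) (bit b))) W
      ≡⟨ cong₂ _-_ (∑-mask k (cond k) a k-bounded) (∑-mask (k + 1ℤ) (cond (k + 1ℤ)) b k+1-bounded) ⟩
    mask (cond k) (bit a) - mask (cond (k + 1ℤ)) (bit b) ∎
    where open ≡-Reasoning

  wtᴹ-profile : wtᴹ m i ≡ bit a - bit b
  wtᴹ-profile = sumOver-profile (λ _ → true)

  private
    sum≤-profile : ∀ l → sum≤ m i l ≡ mask (does (k ℤ.≤? l)) (bit a) - mask (does (k + 1ℤ ℤ.≤? l)) (bit b)
    sum≤-profile l = sumOver-profile (λ t → does (t ℤ.≤? l))

    sum≥-profile : ∀ l → sum≥ m i l ≡ mask (does (l ℤ.≤? k)) (bit a) - mask (does (l ℤ.≤? k + 1ℤ)) (bit b)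
    sum≥-profile l = sumOver-profile (λ t → does (l ℤ.≤? t))

    sum≤-k : sum≤ m i k ≡ bit a
    sum≤-k = trans (sum≤-profile k) (trans
      (cong₂ (λ p q → mask p (bit a) - mask q (bit b))
        (dec-true (k ℤ.≤? k) ℤₚ.≤-refl) (dec-false (k + 1ℤ ℤ.≤? k) k+1≰k))
      (ℤₚ.+-identityʳ (bit a)))

    sum≥-k+1 : sum≥ m i (k + 1ℤ) ≡ - bit b
    sum≥-k+1 = trans (sum≥-profile (k + 1ℤ)) (trans
      (cong₂ (λ p q → mask p (bit a) - mask q (bit b))
        (dec-false (k + 1ℤ ℤ.≤? k) k+1≰k) (dec-true (k + 1ℤ ℤ.≤? k + 1ℤ) ℤₚ.≤-refl))
      (ℤₚ.+-identityˡ (- bit b)))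

  -- As the cut-off grows, the partial sums run through 0, then `bit a` at `k`, then `bit a - bit b`
  -- from `k + 1` on. Dually, those for `εᴹ` pass through `- bit b` at `k + 1`.
  φᴹ-profile : φᴹ i m ≡ bit a
  φᴹ-profile = trans (φᴹ-def i m) (foldr-⊔ (bit-≥0 a)
    (Allₚ.map⁺ (All.universal (λ l → subst (ℤ._≤ bit a) (sym (sum≤-profile l)) 
      (mask-minus-≤ (does (k ℤ.≤? l)) (does (k + 1ℤ ℤ.≤? l)) a b)) W))
    (attained a refl))
    where
    attained : ∀ d → a ≡ d → bit a ≡ 0ℤ ⊎ bit a ∈ map (sum≤ m i) W
    attained false eq = inj₁ (cong bit eq)
    attained true  eq = inj₂ (subst (_∈ map (sum≤ m i) W) sum≤-k (∈-map⁺ (sum≤ m i) (∈-window k (k-bounded eq))))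

  εᴹ-profile : εᴹ i m ≡ bit b
  εᴹ-profile = trans (εᴹ-def i m) (trans (cong -_ (foldr-⊓ (ℤₚ.neg-mono-≤ (bit-≥0 b))
    (Allₚ.map⁺ (All.universal (λ l → subst (- bit b ℤ.≤_) (sym (sum≥-profile l)) 
      (mask-minus-≥ (does (l ℤ.≤? k)) (does (l ℤ.≤? k + 1ℤ)) a b)) W))
    (attained b refl)))
    (ℤₚ.neg-involutive (bit b)))
    where
    attained : ∀ d → b ≡ d → - bit b ≡ 0ℤ ⊎ - bit b ∈ map (sum≥ m i) W
    attained false eq = inj₁ (cong (-_ ∘ bit) eq)
    attained true  eq = inj₂ (subst (_∈ map (sum≥ m i) W) sum≥-k+1
      (∈-map⁺ (sum≥ m i) (∈-window (k + 1ℤ) (k+1-bounded eq))))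

  k_f-profile : a ≡ true → k_f i m ≡ k
  k_f-profile refl = trans (k_f-def i m) (foldr-⊓
    -- The default `+ bound m` does not undercut `k`, which lies in the window; any level attaining
    -- the maximum 1 has already passed `k`.
    (ℤₚ.≤-trans (i≤∣i∣ k) (ℤ.+≤+ (k-bounded refl)))
    (All.tabulate λ {l} l∈ → does-true⇒ (k ℤ.≤? l) (mask-minus-≡1 _ (does (k + 1ℤ ℤ.≤? l)) b
      (trans (sym (sum≤-profile l)) (trans (sym (proj₂ (∈-filter⁻ P? {xs = W} l∈))) φᴹ-profile))))
    (inj₂ (∈-filter⁺ P? (∈-window k (k-bounded refl)) (trans φᴹ-profile (sym sum≤-k)))))
    where
    P? : ∀ l → Dec (φᴹ i m ≡ sum≤ m i l)
    P? l = φᴹ i m ℤ.≟ sum≤ m i l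

  kₑ-profile : b ≡ true → kₑ i m ≡ k + 1ℤ
  kₑ-profile refl = trans (kₑ-def i m) (foldr-⊔
    -- Here the default is the left end of the window, hence at most `k + 1`.
    (ℤₚ.≤-trans (ℤₚ.neg-mono-≤ (ℤ.+≤+ (k+1-bounded refl))) (-∣i∣≤i (k + 1ℤ)))
    (All.tabulate λ {l} l∈ → does-true⇒ (l ℤ.≤? k + 1ℤ) (mask-minus-≡-1 (does (l ℤ.≤? k)) _ a
      (trans (cong -_ (sym (sum≥-profile l))) (trans (sym (proj₂ (∈-filter⁻ P? {xs = W} l∈))) εᴹ-profile))))
    (inj₂ (∈-filter⁺ P? (∈-window (k + 1ℤ) (k+1-bounded refl)) (trans εᴹ-profile (sym (cong -_ sum≥-k+1))))))
    where
    P? : ∀ l → Dec (εᴹ i m ≡ - sum≥ m i l)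
    P? l = εᴹ i m ℤ.≟ - sum≥ m i l

-- Monomials ∏_{i : xᵢ = 1} X i k

-- `InX-eᴹ` and `InX-fᴹ` transport the expression along an equation; this removes the transport, so
-- that `dropSquares` is seen to act on a concrete expression.
attach-unless : {P : S → Set} (c : Bool) {a : S} (pa : P a) →
                attach (unless c a) (λ eq → subst P (unless-just c eq) pa) ≡ unless c (a , pa)
attach-unless true  pa = refl
attach-unless false pa = refl

δ-at : ∀ (i : Fin n) k j l → δ i k j l ≡ at k (Λ i j) l
δ-at i k j l with does (i Fin.≟ j) | does (k ℤ.≟ l)
... | true  | true  = refl
... | true  | false = refl
... | false | true  = refl
... | false | false = refl

at-+ : ∀ k u v l → at k u l + at k v l ≡ at k (u + v) l
at-+ k u v l with does (k ℤ.≟ l)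
... | true  = refl
... | false = refl

at-neg : ∀ k u l → - at k u l ≡ at k (- u) l
at-neg k u l with does (k ℤ.≟ l)
... | true  = refl
... | false = refl

at-shift : ∀ k u t → at k u (t - 1ℤ) ≡ at (k + 1ℤ) u t
at-shift k u t = cong (λ p → mask p u) (does-⇔
  (mk⇔ (λ { refl → minus-plus t }) (λ { refl → sym (plus-minus k) }))
  (k ℤ.≟ t - 1ℤ) (k + 1ℤ ℤ.≟ t))
  where
  minus-plus : ∀ a → a - 1ℤ + 1ℤ ≡ a
  minus-plus = solve-∀
  plus-minus : ∀ a → a + 1ℤ - 1ℤ ≡ a
  plus-minus = solve-∀

Λ-self : (i : Fin n) → Λ i i ≡ 1ℤ
Λ-self i = cong bit (dec-true (i Fin.≟ i) refl)

Λ-other : {i j : Fin n} → i ≢ j → Λ i j ≡ 0ℤ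
Λ-other {i = i} {j} i≢j = cong bit (dec-false (i Fin.≟ j) i≢j)

bit-injective : ∀ {p q} → bit p ≡ bit q → p ≡ q
bit-injective {true}  {true}  _ = refl
bit-injective {false} {false} _ = refl

lookup-injective : {x y : Subset n} → (∀ i → lookup x i ≡ lookup y i) → x ≡ y
lookup-injective {x = x} {y} eq =
  trans (sym (tabulate∘lookup x)) (trans (tabulate-cong eq) (tabulate∘lookup y))

module _ .{{_ : NonZero n}} where

  record Represents (k : ℤ) (x : Subset n) (mp : XMonomial {n}) : Set where
    constructor represents
    field
      exponents : ∀ j l → exponent (expression (proj₂ mp)) j l ≡ at k (coord x j) l
  open Represents

  dropSquares-just : ∀ {mp : XMonomial {n}} → SquareFree (expression (proj₂ mp)) → dropSquares mp ≡ just mp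
  dropSquares-just {m , p} sf =
    cong (λ c → if c then just (m , p) else nothing) (dec-true (squareFree? (expression p)) sf)

  dropSquares-nothing : ∀ {mp : XMonomial {n}} → ¬ SquareFree (expression (proj₂ mp)) → dropSquares mp ≡ nothing
  dropSquares-nothing {m , p} ¬sf =
    cong (λ c → if c then just (m , p) else nothing) (dec-false (squareFree? (expression p)) ¬sf)

  module _ {k : ℤ} where

    represents⇒profile : ∀ {x m} {p : InX m} → Represents k x (m , p) → ∀ i t →
                         exponent m i t ≡ at k (coord x i) t - at (k + 1ℤ) (coord x (next i)) t
    represents⇒profile {x} {m} {p} rep i t = trans (sym (expands p i t))
      (cong₂ _-_ (exponents rep i t) (trans (exponents rep (next i) (t - 1ℤ)) (at-shift k (coord x (next i)) t)))

    -- At level `k` the negative part of the profile, living at `k + 1`, disappears, and the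
    -- exponent of `Y i k` is xᵢ itself.
    represents-unique : ∀ {x y m m′} {p : InX m} {p′ : InX m′} →
                        Represents k x (m , p) → Represents k y (m′ , p′) → m ≋ m′ → x ≡ y
    represents-unique {x} {y} {m} {m′} {p} {p′} rep rep′ m≋m′ = lookup-injective λ i → bit-injective (begin
      coord x i                                           ≡⟨ at-k (coord x i) (coord x (next i)) ⟨
      at k (coord x i) k - at (k + 1ℤ) (coord x (next i)) k ≡⟨ represents⇒profile rep i k ⟨
      exponent m i k                                      ≡⟨ m≋m′ i k ⟩
      exponent m′ i k                                     ≡⟨ represents⇒profile rep′ i k ⟩
      at k (coord y i) k - at (k + 1ℤ) (coord y (next i)) k ≡⟨ at-k (coord y i) (coord y (next i)) ⟩
      coord y i                                           ∎)
      where
      open ≡-Reasoning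
      at-k : ∀ u v → at k u k - at (k + 1ℤ) v k ≡ u
      at-k u v = trans (cong₂ _-_ (at-self k u)
        (at-other v λ eq → ℤₚ.i≢suc[i] (trans (sym eq) (ℤₚ.+-comm k 1ℤ)))) (ℤₚ.+-identityʳ u)

    represents⇒squareFree : ∀ {x mp} → Represents k x mp → SquareFree (expression (proj₂ mp))
    represents⇒squareFree {x} rep j l 2≤ =
      small (does (k ℤ.≟ l)) (lookup x j) (subst (+ 2 ℤ.≤_) (exponents rep j l) 2≤)
      where
      small : ∀ p b → ¬ (+ 2 ℤ.≤ mask p (bit b))
      small true  true  (ℤ.+≤+ (s≤s ()))
      small true  false (ℤ.+≤+ ())
      small false b     (ℤ.+≤+ ())

    -- Common core of `ē` and `f̄`. The exponent formula makes sense whether or not `b` is occupied: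
    -- a free `b` gives the coordinates of the moved vector, an occupied one gives exponent 1 - 0 +
    -- 1 = 2 at `b`.
    dropSquares-move : ∀ {a b x m′} (q : InX m′) → a ≢ b → lookup x a ≡ true →
      (∀ j l → exponent (expression q) j l ≡ at k (coord x j - Λ a j + Λ b j) l) →
      Pointwise (Represents k) (move a b x) (dropSquares (m′ , q))
    dropSquares-move {a} {b} {x} {m′} q a≢b xa eq = go (lookup x b) refl
      where
      go : ∀ v → lookup x b ≡ v → Pointwise (Represents k) (move a b x) (dropSquares (m′ , q))
      go false xb = subst₂ (Pointwise (Represents k)) (sym mv)
        (sym (dropSquares-just (represents⇒squareFree rep))) (just rep)
        where
        x′ : Subset n
        x′ = x [ a ]≔ false [ b ]≔ true
        mv : move a b x ≡ just x′
        mv = move-just a b x xa xb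
        rep : Represents k x′ (m′ , q)
        rep = represents λ j l → trans (eq j l) (cong (λ c → at k c l) (sym (coord-move x a≢b mv j)))
      go true xb = subst₂ (Pointwise (Represents k))
        (sym (move-nothing a b x (cong₂ (λ p q → p ∧ not q) xa xb)))
        (sym (dropSquares-nothing λ sf → sf b k (ℤₚ.≤-reflexive (sym square))))
        nothing
        where
        square : exponent (expression q) b k ≡ + 2
        square = trans (eq b k) (trans (at-self k _)
          (cong₂ _+_ (cong₂ _-_ (cong bit xb) (Λ-other a≢b)) (Λ-self b)))

    represents-exchange : ∀ {x mp} → Represents k x mp → ∀ a b j l →
      exponent (expression (proj₂ mp)) j l - δ a k j l + δ b k j l ≡ at k (coord x j - Λ a j + Λ b j) l
    represents-exchange {x} {mp} rep a b j l = begin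
      exponent (expression (proj₂ mp)) j l - δ a k j l + δ b k j l
        ≡⟨ cong₂ _+_ (cong₂ _-_ (exponents rep j l) (δ-at a k j l)) (δ-at b k j l) ⟩
      at k (coord x j) l - at k (Λ a j) l + at k (Λ b j) l
        ≡⟨ cong (λ c → at k (coord x j) l + c + at k (Λ b j) l) (at-neg k (Λ a j) l) ⟩
      at k (coord x j) l + at k (- Λ a j) l + at k (Λ b j) l
        ≡⟨ cong (_+ at k (Λ b j) l) (at-+ k (coord x j) (- Λ a j) l) ⟩
      at k (coord x j - Λ a j) l + at k (Λ b j) l
        ≡⟨ at-+ k (coord x j - Λ a j) (Λ b j) l ⟩
      at k (coord x j - Λ a j + Λ b j) l ∎
      where open ≡-Reasoning

    -- The modified operators on representing monomials

    module _ (1<n : 1 < n) where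

      -- The two ways a move can fail have different causes: an empty source makes `φᴹ` vanish,
      -- whereas for an occupied target `fᴹ` is nonzero and only `dropSquares-move` removes the
      -- result.
      f̄-represents : ∀ i {x mp} → Represents k x mp → Pointwise (Represents k) (move i (next i) x) (f̄ i mp)
      f̄-represents i {x} {m , p} rep =
        subst (Pointwise (Represents k) (move i (next i) x))
          (cong (Maybe._>>= dropSquares) (sym (attach-unless {P = InX} (does (φᴹ i m ℤ.≟ 0ℤ)) q)))
          (go (lookup x i) refl)
        where
        q : InX (m · A i (k_f i m) ⁻¹)
        q = InX-· p (InX-⁻¹ (InX-A i (k_f i m)))

        profile : ∀ t → exponent m i t ≡ at k (coord x i) t - at (k + 1ℤ) (coord x (next i)) t
        profile = represents⇒profile rep i

        go : ∀ v → lookup x i ≡ v → Pointwise (Represents k) (move i (next i) x)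
               (unless (does (φᴹ i m ℤ.≟ 0ℤ)) (m · A i (k_f i m) ⁻¹ , q) Maybe.>>= dropSquares)
        go false xi = subst₂ (Pointwise (Represents k))
          (sym (move-nothing i (next i) x (cong (_∧ not (lookup x (next i))) xi)))
          (cong (λ c → unless c (m · A i (k_f i m) ⁻¹ , q) Maybe.>>= dropSquares)
            (sym (dec-true (φᴹ i m ℤ.≟ 0ℤ)
              (trans (φᴹ-profile k (lookup x i) (lookup x (next i)) profile) (cong bit xi)))))
          nothing
        go true xi = subst (Pointwise (Represents k) (move i (next i) x))
          (cong (λ c → unless c (m · A i (k_f i m) ⁻¹ , q) Maybe.>>= dropSquares)
            (sym (dec-false (φᴹ i m ℤ.≟ 0ℤ) λ φ≡0 → contradiction
              (trans (sym (trans (φᴹ-profile k (lookup x i) (lookup x (next i)) profile)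
                (cong bit xi))) φ≡0) λ ())))
          (dropSquares-move q (i≢next 1<n i) xi exponents-q)
          where
          exponents-q : ∀ j l → exponent (expression q) j l ≡ at k (coord x j - Λ i j + Λ (next i) j) l
          exponents-q j l = begin
            exponent (expression p) j l + - (δ i (k_f i m) j l + - δ (next i) (k_f i m) j l)
              ≡⟨ cong (λ h → exponent (expression p) j l + - (δ i h j l + - δ (next i) h j l))
                   (k_f-profile k (lookup x i) (lookup x (next i)) profile xi) ⟩
            exponent (expression p) j l + - (δ i k j l + - δ (next i) k j l)
              ≡⟨ rearrange (exponent (expression p) j l) (δ i k j l) (δ (next i) k j l) ⟩
            exponent (expression p) j l - δ i k j l + δ (next i) k j l
              ≡⟨ represents-exchange rep i (next i) j l ⟩
            at k (coord x j - Λ i j + Λ (next i) j) l ∎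
            where
            open ≡-Reasoning
            rearrange : ∀ u c d → u + - (c + - d) ≡ u - c + d
            rearrange = solve-∀

      ē-represents : ∀ i {x mp} → Represents k x mp → Pointwise (Represents k) (move (next i) i x) (ē i mp)
      ē-represents i {x} {m , p} rep =
        subst (Pointwise (Represents k) (move (next i) i x))
          (cong (Maybe._>>= dropSquares) (sym (attach-unless {P = InX} (does (εᴹ i m ℤ.≟ 0ℤ)) q)))
          (go (lookup x (next i)) refl)
        where
        q : InX (m · A i (kₑ i m - 1ℤ))
        q = InX-· p (InX-A i (kₑ i m - 1ℤ))

        profile : ∀ t → exponent m i t ≡ at k (coord x i) t - at (k + 1ℤ) (coord x (next i)) t
        profile = represents⇒profile rep i

        go : ∀ v → lookup x (next i) ≡ v → Pointwise (Represents k) (move (next i) i x)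
               (unless (does (εᴹ i m ℤ.≟ 0ℤ)) (m · A i (kₑ i m - 1ℤ) , q) Maybe.>>= dropSquares)
        go false xi+1 = subst₂ (Pointwise (Represents k))
          (sym (move-nothing (next i) i x (cong (_∧ not (lookup x i)) xi+1)))
          (cong (λ c → unless c (m · A i (kₑ i m - 1ℤ) , q) Maybe.>>= dropSquares)
            (sym (dec-true (εᴹ i m ℤ.≟ 0ℤ)
              (trans (εᴹ-profile k (lookup x i) (lookup x (next i)) profile) (cong bit xi+1)))))
          nothing
        go true xi+1 = subst (Pointwise (Represents k) (move (next i) i x))
          (cong (λ c → unless c (m · A i (kₑ i m - 1ℤ) , q) Maybe.>>= dropSquares)
            (sym (dec-false (εᴹ i m ℤ.≟ 0ℤ) λ ε≡0 → contradiction
              (trans (sym (trans (εᴹ-profile k (lookup x i) (lookup x (next i)) profile)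
                (cong bit xi+1))) ε≡0) λ ())))
          (dropSquares-move q (i≢next 1<n i ∘ sym) xi+1 exponents-q)
          where
          exponents-q : ∀ j l → exponent (expression q) j l ≡ at k (coord x j - Λ (next i) j + Λ i j) l
          exponents-q j l = begin
            exponent (expression p) j l + (δ i (kₑ i m - 1ℤ) j l + - δ (next i) (kₑ i m - 1ℤ) j l)
              ≡⟨ cong (λ h → exponent (expression p) j l + (δ i h j l + - δ (next i) h j l))
                   -- The shift by 1 in `eᴹ` compensates for `kₑ` being `k + 1`, so the factor sits
                   -- at level `k` again.
                   (trans (cong (_- 1ℤ) (kₑ-profile k (lookup x i) (lookup x (next i)) profile xi+1)) (k+1-1 k)) ⟩
            exponent (expression p) j l + (δ i k j l + - δ (next i) k j l)
              ≡⟨ rearrange (exponent (expression p) j l) (δ i k j l) (δ (next i) k j l) ⟩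
            exponent (expression p) j l - δ (next i) k j l + δ i k j l
              ≡⟨ represents-exchange rep (next i) i j l ⟩
            at k (coord x j - Λ (next i) j + Λ i j) l ∎
            where
            open ≡-Reasoning
            rearrange : ∀ u c d → u + (c + - d) ≡ u - d + c
            rearrange = solve-∀
            k+1-1 : ∀ c → c + 1ℤ - 1ℤ ≡ c
            k+1-1 = solve-∀

-- Connectedness

-- Adjacency is linear, without wrap-around: prepending an entry preserves it, while `next` depends
-- on the length. This permits induction on the vector.
AdjacentMove : Subset n → Subset n → Set
AdjacentMove x y = ∃₂ λ a b → toℕ b ≡ suc (toℕ a) × (move a b x ≡ just y ⊎ move b a x ≡ just y)

AdjacentMove-sym : {x y : Subset n} → AdjacentMove x y → AdjacentMove y x
AdjacentMove-sym {x = x} (a , b , b≡1+a , moves) =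
  a , b , b≡1+a , Sum.swap (Sum.map (move-inverse x a≢b) (move-inverse x (a≢b ∘ sym)) moves)
  where
  a≢b : a ≢ b
  a≢b refl = ℕₚ.1+n≢n (sym b≡1+a)

move-∷ : ∀ c a b (x : Subset n) → move (Fin.suc a) (Fin.suc b) (c ∷ x) ≡ Maybe.map (c ∷_) (move a b x)
move-∷ c a b x with lookup x a ∧ not (lookup x b)
... | true  = refl
... | false = refl

AdjacentMove-∷ : ∀ c {x y : Subset n} → AdjacentMove x y → AdjacentMove (c ∷ x) (c ∷ y)
AdjacentMove-∷ c {x} (a , b , b≡1+a , moves) =
  Fin.suc a , Fin.suc b , cong suc b≡1+a , Sum.map (cons a b) (cons b a) moves
  where
  cons : ∀ a b {y} → move a b x ≡ just y → move (Fin.suc a) (Fin.suc b) (c ∷ x) ≡ just (c ∷ y)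
  cons a b eq = trans (move-∷ c a b x) (cong (Maybe.map (c ∷_)) eq)

-- The first particle of `y` is carried leftwards to the head, one place at a time.
extract-true : ∀ (y : Subset n) {p} → ∣ y ∣ ≡ suc p →
               ∃ λ z → ∣ z ∣ ≡ p × Star AdjacentMove (false ∷ y) (true ∷ z)
extract-true (true  ∷ y) ∣y∣ = false ∷ y , ℕₚ.suc-injective ∣y∣ ,
  (Fin.zero , Fin.suc Fin.zero , refl , inj₂ refl) ◅ ε
extract-true (false ∷ y) ∣y∣ with extract-true y ∣y∣
... | z , ∣z∣ , moves = false ∷ z , ∣z∣ ,
  gmap (false ∷_) (AdjacentMove-∷ false) moves ◅◅ (Fin.zero , Fin.suc Fin.zero , refl , inj₂ refl) ◅ ε

connected : ∀ (x y : Subset n) → ∣ x ∣ ≡ ∣ y ∣ → Star AdjacentMove x y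
connected []          []          eq = ε
connected (true  ∷ x) (true  ∷ y) eq = gmap (true ∷_) (AdjacentMove-∷ true) (connected x y (ℕₚ.suc-injective eq))
connected (false ∷ x) (false ∷ y) eq = gmap (false ∷_) (AdjacentMove-∷ false) (connected x y eq)
-- With different heads, a particle is extracted on the side whose head is empty; here that is the
-- target, so the path is traversed backwards.
connected (true  ∷ x) (false ∷ y) eq with extract-true y (sym eq)
... | z , ∣z∣ , moves =
  gmap (true ∷_) (AdjacentMove-∷ true) (connected x z (sym ∣z∣)) ◅◅ reverse AdjacentMove-sym moves
connected (false ∷ x) (true  ∷ y) eq with extract-true x eq
... | z , ∣z∣ , moves = moves ◅◅ gmap (true ∷_) (AdjacentMove-∷ true) (connected z y ∣z∣)

next-adjacent : .{{_ : NonZero n}} {a b : Fin n} → toℕ b ≡ suc (toℕ a) → next a ≡ b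
next-adjacent {n} {a} {b} b≡1+a = Finₚ.toℕ-injective
  (trans (toℕ-mod (subst (_< n) b≡1+a (Finₚ.toℕ<n b))) (sym b≡1+a))

move-of : {R : S → T → Set} {o : Maybe S} {o′ : Maybe T} {y : T} →
          Pointwise R o o′ → o′ ≡ just y → ∃ λ x → o ≡ just x × R x y
move-of (just r) refl = _ , refl , r

-- The fuel in `M̄` is the bit of the source place. It differs from 1 only when the source is empty,
-- and then there is no step to count.
enough-fuel : (op : S → Maybe S) (s : S) (b : Bool) → (b ≡ false → op s ≡ nothing) →
              stringLength ℤ.∣ bit b ∣ op s ≡ stringLength 1 op s
enough-fuel op s true  _    = refl
enough-fuel op s false stop = sym (cong (maybe′ (λ _ → 1) 0) (stop refl))

-- The correspondence between B^{r,1} and M̄ (∏ᵢ X i k)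

module _ .{{_ : NonZero n}} (k : ℤ) where

  -- The bound on occupied places is the induction invariant: it leaves `suc r` free for the next
  -- factor, and `r < n` prevents that index from wrapping around.
  ∏X-represented : ∀ r → r < n → ∃ λ (x : Subset n) →
                   ∣ x ∣ ≡ r × (∀ j → lookup x j ≡ true → toℕ j ≤ r) × Represents k x (∏X r k)
  ∏X-represented zero    0<n   = Subset.⊥ , ∣⊥∣≡0 n
    , (λ j eq → contradiction (trans (sym eq) (lookup-replicate j false)) λ ())
    , represents λ j l → sym (trans (cong (λ b → at k (bit b) l) (lookup-replicate j false)) (at-0 l))
    where
    at-0 : ∀ l → at k 0ℤ l ≡ 0ℤ
    at-0 l with does (k ℤ.≟ l)
    ... | true  = refl
    ... | false = refl
  ∏X-represented (suc r) 1+r<n with ∏X-represented r (ℕₚ.<-trans (ℕₚ.n<1+n r) 1+r<n)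
  ... | x , ∣x∣ , x≤r , rep = x [ a ]≔ true , trans (∣set-true∣ x a xa) (cong suc ∣x∣) , ≤1+r , rep′
    where
    a : Fin n
    a = suc r mod n
    a≡1+r : toℕ a ≡ suc r
    a≡1+r = toℕ-mod 1+r<n
    xa : lookup x a ≡ false
    xa = ¬-not λ eq → ℕₚ.1+n≰n (subst (_≤ r) a≡1+r (x≤r a eq))
    ≤1+r : ∀ j → lookup (x [ a ]≔ true) j ≡ true → toℕ j ≤ suc r
    ≤1+r j eq with j Fin.≟ a
    ... | yes refl = ℕₚ.≤-reflexive a≡1+r
    ... | no  j≢a  = ℕₚ.m≤n⇒m≤1+n (x≤r j (trans (sym (lookup∘update′ j≢a x true)) eq))
    rep′ : Represents k (x [ a ]≔ true) (∏X (suc r) k)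
    rep′ = represents λ j l → begin
      exponent (expression (proj₂ (∏X r k))) j l + δ a k j l
        ≡⟨ cong₂ _+_ (Represents.exponents rep j l) (δ-at a k j l) ⟩
      at k (coord x j) l + at k (Λ a j) l
        ≡⟨ at-+ k (coord x j) (Λ a j) l ⟩
      at k (coord x j + Λ a j) l
        ≡⟨ cong (λ c → at k c l) (coord-set-true x a xa j) ⟨
      at k (coord (x [ a ]≔ true) j) l ∎
      where open ≡-Reasoning

  module _ (1<n : 1 < n) {r : ℕ} (r<n : r < n) where

    Closure⇒represented : ∀ {mp} → Closure (∏X r k) mp → ∃ λ x → ∣ x ∣ ≡ r × Represents k x mp
    Closure⇒represented base = let x , ∣x∣ , _ , rep = ∏X-represented r r<n in x , ∣x∣ , rep
    Closure⇒represented (step-ē i c eq) =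
      let x , ∣x∣ , rep = Closure⇒represented c
          x′ , mv , rep′ = move-of (ē-represents 1<n i rep) eq
      in x′ , trans (∣move∣ (next i) i x mv) ∣x∣ , rep′
    Closure⇒represented (step-f̄ i c eq) =
      let x , ∣x∣ , rep = Closure⇒represented c
          x′ , mv , rep′ = move-of (f̄-represents 1<n i rep) eq
      in x′ , trans (∣move∣ i (next i) x mv) ∣x∣ , rep′

    Reached : Subset n → Set
    Reached x = ∃ λ mp → Closure (∏X r k) mp × Represents k x mp

    reached-step : ∀ {x y} → AdjacentMove x y → Reached x → Reached y
    -- Linear neighbours are cyclic ones, so a rightward move is realised by `f̄ a` and a leftward
    -- one by `ē a`.
    reached-step {x} {y} (a , b , b≡1+a , moves) (mp , c , rep) with next-adjacent {a = a} {b} b≡1+a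
    reached-step {x} {y} (a , _ , b≡1+a , inj₁ mv) (mp , c , rep) | refl =
      let mp′ , eq , rep′ = just-inv
            (subst (λ o → Pointwise (Represents k) o (f̄ a mp)) mv (f̄-represents 1<n a rep))
      in mp′ , step-f̄ a c eq , rep′
    reached-step {x} {y} (a , _ , b≡1+a , inj₂ mv) (mp , c , rep) | refl =
      let mp′ , eq , rep′ = just-inv
            (subst (λ o → Pointwise (Represents k) o (ē a mp)) mv (ē-represents 1<n a rep))
      in mp′ , step-ē a c eq , rep′

    reached : ∀ x → ∣ x ∣ ≡ r → Reached x
    reached x ∣x∣ =
      let x₀ , ∣x₀∣ , _ , rep = ∏X-represented r r<n
      in fold (λ x y → Reached x → Reached y) (λ mv go → go ∘ reached-step mv) (λ p → p)
           (connected x₀ x (trans ∣x₀∣ (sym ∣x∣))) (∏X r k , base , rep)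

    private
      module B = PreCrystal (KR n r)
      module C = PreCrystal (M̄ {n} (∏X r k))

      R : B.Carrier → C.Carrier → Set
      R b c = Represents k (proj₁ b) (proj₁ c)

      R-e : ∀ i {b c} → R b c → Pointwise R (B.e i b) (C.e i c)
      R-e i {x , _} {mp , _} rep = attach⁺ (ē-represents 1<n i rep) _ _

      R-f : ∀ i {b c} → R b c → Pointwise R (B.f i b) (C.f i c)
      R-f i {x , _} {mp , _} rep = attach⁺ (f̄-represents 1<n i rep) _ _

      -- The string is first transferred to `KR` with the fuel kept fixed; only then is the fuel
      -- evaluated and replaced by 1.
      R-ε : ∀ i {b c} → R b c → C.ε i c ≡ B.ε i b
      R-ε i {b@(x , _)} {c@((m , p) , _)} rep = cong +_ (begin
        stringLength ℤ.∣ εᴹ i m ∣ (C.e i) c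
          ≡⟨ stringLength⁺ (λ {b} {c} → R-e i {b} {c}) ℤ.∣ εᴹ i m ∣ {b} {c} rep ⟨
        stringLength ℤ.∣ εᴹ i m ∣ (B.e i) b
          ≡⟨ cong (λ z → stringLength ℤ.∣ z ∣ (B.e i) b)
               (εᴹ-profile k (lookup x i) (lookup x (next i)) (represents⇒profile rep i)) ⟩
        stringLength ℤ.∣ bit (lookup x (next i)) ∣ (B.e i) b
          ≡⟨ enough-fuel (B.e i) b (lookup x (next i))
               (λ eq → is-just-false _ (trans (is-just-KR-e 1<n r i b) (cong (_∧ not (lookup x i)) eq))) ⟩
        stringLength 1 (B.e i) b ∎)
        where open ≡-Reasoning

      R-φ : ∀ i {b c} → R b c → C.φ i c ≡ B.φ i b
      R-φ i {b@(x , _)} {c@((m , p) , _)} rep = cong +_ (begin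
        stringLength ℤ.∣ φᴹ i m ∣ (C.f i) c
          ≡⟨ stringLength⁺ (λ {b} {c} → R-f i {b} {c}) ℤ.∣ φᴹ i m ∣ {b} {c} rep ⟨
        stringLength ℤ.∣ φᴹ i m ∣ (B.f i) b
          ≡⟨ cong (λ z → stringLength ℤ.∣ z ∣ (B.f i) b)
               (φᴹ-profile k (lookup x i) (lookup x (next i)) (represents⇒profile rep i)) ⟩
        stringLength ℤ.∣ bit (lookup x i) ∣ (B.f i) b
          ≡⟨ enough-fuel (B.f i) b (lookup x i)
               (λ eq → is-just-false _ (trans (is-just-KR-f 1<n r i b) (cong (_∧ not (lookup x (next i))) eq))) ⟩
        stringLength 1 (B.f i) b ∎)
        where open ≡-Reasoning

    KR-M̄-correspondence : Correspondence (KR n r) (M̄ {n} (∏X r k))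
    KR-M̄-correspondence = record
      { R      = R
      ; totalˡ = λ (x , ∣x∣) → let mp , c , rep = reached x ∣x∣ in (mp , c) , rep
      ; totalʳ = λ (mp , c) → let x , ∣x∣ , rep = Closure⇒represented c in (x , ∣x∣) , rep
      ; R-≈ʳ   = λ { rep rep′ refl i t → trans (represents⇒profile rep i t) (sym (represents⇒profile rep′ i t)) }
      ; R-≈ˡ   = represents-unique
      ; R-wt   = λ { {x , _} {(m , _) , _} rep j →
                     wtᴹ-profile {m = m} {j} k (lookup x j) (lookup x (next j)) (represents⇒profile rep j) }
      ; R-ε    = λ i {b} {c} → R-ε i {b} {c}
      ; R-φ    = λ i {b} {c} → R-φ i {b} {c}
      ; R-e    = λ i {b} {c} → R-e i {b} {c}
      ; R-f    = λ i {b} {c} → R-f i {b} {c}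
      }

proposition5p2 : ∀ (n : ℕ) .{{_ : NonZero n}} → 3 ≤ n →
    ∀ (r : ℕ) → 1 ≤ r → r < n → ∀ (k : ℤ) →
    IsRegularCrystal (KR n r) ×
    IsRegularCrystal (M̄ {n} (∏X r k)) ×
    (KR n r ≅ M̄ {n} (∏X r k))
proposition5p2 n 3≤n r 1≤r r<n k =
  regular , correspondence⇒isRegular corr regular , correspondence⇒≅ corr
  where
  1<n : 1 < n
  1<n = ℕₚ.≤-trans (s≤s (s≤s z≤n)) 3≤n
  regular : IsRegularCrystal (KR n r)
  regular = KR-isRegular 1<n r
  corr : Correspondence (KR n r) (M̄ {n} (∏X r k))
  corr = KR-M̄-correspondence k 1<n r<n
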